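{- An ordered vector space over an ordered division ring cannot trace define an infinite field.
   Context: An ordered vector space over an ordered division ring $\mathbb{D}$ is an ordered abelian group $(V;+,<)$ with a $\mathbb{D}$-vector space structure, regarded as the structure $(V;+,<,(t\mapsto\lambda t)_{\lambda\in\mathbb{D}})$, in which multiplication by positive scalars preserves the order. For structures $\mathcal{M},\mathcal{O}$, $\mathcal{M}$ trace defines $\mathcal{O}$ if there is an injection $\tau\colon O\to M^m$ such that for every $\mathcal{O}$-definable (with parameters) $X\subseteq O^n$ there is an $\mathcal{M}$-definable (with parameters) $Y\subseteq M^{mn}$ with $(a_1,\dots,a_n)\in X\iff(\tau(a_1),\dots,\tau(a_n))\in Y$ for all $a_i\in O$. "Trace defines an infinite field" means trace defines some infinite field $(F;+,\times)$. -}

module Defs where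

open import Level using (0ℓ)
open import Data.Nat as ℕ using (ℕ)
open import Data.Fin using (Fin)
open import Data.Vec using (Vec; []; _∷_; lookup; _++_; concat; map)
open import Data.Product using (Σ; Σ-syntax; _×_; ∃; _,_)
open import Data.Sum using (_⊎_)
open import Data.Empty using (⊥)
open import Relation.Nullary using (¬_)
open import Relation.Binary.PropositionalEquality using (_≡_)
open import Relation.Binary.Structures using (IsStrictTotalOrder)
open import Algebra.Structures using (IsRing; IsCommutativeRing; IsAbelianGroup)
open import Function.Definitions using (Injective; Surjective)
open import Function.Bundles using (_⇔_)

record Language : Set₁ where
  field
    Fun : ℕ → Set
    Rel : ℕ → Set

open Language public

record Structure (L : Language) : Set₁ where
  field
    Carrier : Set
    funᴵ    : ∀ {k} → Fun L k → Vec Carrier k → Carrier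
    relᴵ    : ∀ {k} → Rel L k → Vec Carrier k → Set

open Structure public

data Term (L : Language) (n : ℕ) : Set where
  var : Fin n → Term L n
  app : ∀ {k} → Fun L k → Vec (Term L n) k → Term L n

-- first-order formulas (with equality) with free variables among Fin n;
-- quantifiers bind variable 0 (de Bruijn)
data Formula (L : Language) : ℕ → Set where
  rel  : ∀ {n k} → Rel L k → Vec (Term L n) k → Formula L n
  equ  : ∀ {n} → Term L n → Term L n → Formula L n
  fls  : ∀ {n} → Formula L n
  neg  : ∀ {n} → Formula L n → Formula L n
  conj : ∀ {n} → Formula L n → Formula L n → Formula L n
  disj : ∀ {n} → Formula L n → Formula L n → Formula L n
  impl : ∀ {n} → Formula L n → Formula L n → Formula L n
  all  : ∀ {n} → Formula L (ℕ.suc n) → Formula L n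
  ex   : ∀ {n} → Formula L (ℕ.suc n) → Formula L n

module _ {L : Language} (M : Structure L) where

  mutual
    eval : ∀ {n} → Term L n → Vec (Carrier M) n → Carrier M
    eval (var i)    ρ = lookup ρ i
    eval (app f ts) ρ = funᴵ M f (evals ts ρ)

    evals : ∀ {n k} → Vec (Term L n) k → Vec (Carrier M) n → Vec (Carrier M) k
    evals []       ρ = []
    evals (t ∷ ts) ρ = eval t ρ ∷ evals ts ρ

  Sat : ∀ {n} → Formula L n → Vec (Carrier M) n → Set
  Sat (rel r ts)   ρ = relᴵ M r (evals ts ρ)
  Sat (equ s t)    ρ = eval s ρ ≡ eval t ρ
  Sat fls          ρ = ⊥
  Sat (neg φ)      ρ = ¬ Sat φ ρ
  Sat (conj φ ψ)   ρ = Sat φ ρ × Sat ψ ρ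
  Sat (disj φ ψ)   ρ = Sat φ ρ ⊎ Sat ψ ρ
  Sat (impl φ ψ)   ρ = Sat φ ρ → Sat ψ ρ
  Sat (all φ)      ρ = (a : Carrier M) → Sat φ (a ∷ ρ)
  Sat (ex φ)       ρ = Σ (Carrier M) λ a → Sat φ (a ∷ ρ)

-- Trace definability
--
-- An O-definable (with parameters) set X ⊆ Oⁿ is given by a formula
-- φ(x₁..xₙ, y₁..y_k) and parameters c ∈ Oᵏ:  X = { a | O ⊨ φ(a, c) }.
-- M trace defines O iff there is an injection τ : O → Mᵐ such that every
-- such X is the τ-preimage of an M-definable (with parameters) Y ⊆ M^{nm}.

TraceDefines : ∀ {LM LO : Language} → Structure LM → Structure LO → Set
TraceDefines {LM} {LO} M O =
  Σ[ m ∈ ℕ ] Σ[ τ ∈ (Carrier O → Vec (Carrier M) m) ]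
    Injective _≡_ _≡_ τ ×
    ((n k : ℕ) (φ : Formula LO (n ℕ.+ k)) (c : Vec (Carrier O) k) →
      Σ[ k′ ∈ ℕ ] Σ[ ψ ∈ Formula LM (n ℕ.* m ℕ.+ k′) ] Σ[ d ∈ Vec (Carrier M) k′ ]
        ((a : Vec (Carrier O) n) →
          Sat O φ (a ++ c) ⇔ Sat M ψ (concat (map τ a) ++ d)))

record OrderedDivisionRing : Set₁ where
  field
    Carrier : Set
    _+_ _*_ : Carrier → Carrier → Carrier
    -_      : Carrier → Carrier
    0# 1#   : Carrier
    _<_     : Carrier → Carrier → Set
    isRing  : IsRing _≡_ _+_ _*_ -_ 0# 1#
    0≢1     : ¬ (0# ≡ 1#)
    inverse : ∀ x → ¬ (x ≡ 0#) → Σ[ y ∈ Carrier ] ((x * y ≡ 1#) × (y * x ≡ 1#))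
    isStrictTotalOrder : IsStrictTotalOrder _≡_ _<_
    +-mono-<  : ∀ {x y} z → x < y → (x + z) < (y + z)
    *-pos     : ∀ {x y} → 0# < x → 0# < y → 0# < (x * y)

record OrderedVectorSpace (D : OrderedDivisionRing) : Set₁ where
  module D = OrderedDivisionRing D
  field
    Carrier : Set
    _+_     : Carrier → Carrier → Carrier
    -_      : Carrier → Carrier
    0#      : Carrier
    _<_     : Carrier → Carrier → Set
    _·_     : D.Carrier → Carrier → Carrier
    isAbelianGroup     : IsAbelianGroup _≡_ _+_ 0# -_
    isStrictTotalOrder : IsStrictTotalOrder _≡_ _<_
    +-mono-<  : ∀ {u v} w → u < v → (u + w) < (v + w)
    ·-distribˡ : ∀ λ′ u v → λ′ · (u + v) ≡ (λ′ · u) + (λ′ · v)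
    ·-distribʳ : ∀ λ′ μ u → (λ′ D.+ μ) · u ≡ (λ′ · u) + (μ · u)
    ·-assoc    : ∀ λ′ μ u → (λ′ D.* μ) · u ≡ λ′ · (μ · u)
    ·-identity : ∀ u → D.1# · u ≡ u
    ·-mono-<   : ∀ {λ′ u v} → D.0# D.< λ′ → u < v → (λ′ · u) < (λ′ · v)

data OVSFun (S : Set) : ℕ → Set where
  plus : OVSFun S 2
  scal : S → OVSFun S 1

data OVSRel : ℕ → Set where
  less : OVSRel 2

OVSLanguage : Set → Language
OVSLanguage S = record { Fun = OVSFun S ; Rel = OVSRel }

ovsStructure : ∀ {D} → OrderedVectorSpace D →
               Structure (OVSLanguage (OrderedDivisionRing.Carrier D))
ovsStructure V = record
  { Carrier = OrderedVectorSpace.Carrier V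
  ; funᴵ = λ { plus (u ∷ v ∷ []) → OrderedVectorSpace._+_ V u v
             ; (scal c) (u ∷ []) → OrderedVectorSpace._·_ V c u }
  ; relᴵ = λ { less (u ∷ v ∷ []) → OrderedVectorSpace._<_ V u v }
  }

record Field : Set₁ where
  field
    Carrier : Set
    _+_ _*_ : Carrier → Carrier → Carrier
    -_      : Carrier → Carrier
    0# 1#   : Carrier
    isCommutativeRing : IsCommutativeRing _≡_ _+_ _*_ -_ 0# 1#
    0≢1     : ¬ (0# ≡ 1#)
    inverse : ∀ x → ¬ (x ≡ 0#) → Σ[ y ∈ Carrier ] (x * y ≡ 1#)

data RingFun : ℕ → Set where
  add mul : RingFun 2

data NoRel : ℕ → Set where

RingLanguage : Language
RingLanguage = record { Fun = RingFun ; Rel = NoRel }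

fieldStructure : Field → Structure RingLanguage
fieldStructure F = record
  { Carrier = Field.Carrier F
  ; funᴵ = λ { add (x ∷ y ∷ []) → Field._+_ F x y
             ; mul (x ∷ y ∷ []) → Field._*_ F x y }
  ; relᴵ = λ ()
  }

Finite : Set → Set
Finite A = Σ[ n ∈ ℕ ] Σ[ f ∈ (Fin n → A) ] Surjective _≡_ _≡_ f

Infinite : Set → Set
Infinite A = ¬ Finite A

{-# OPTIONS --safe #-}

-- By quantifier elimination, truth of a formula in V depends only on the signs of
-- finitely many linear forms. Hence, if V trace defines F, there are N functions
-- uᵢ on points and wᵢ on lines of the plane over F, with values in V, such that the
-- incidence y = a x + b is determined by the N comparisons of uᵢ(x,y) with wᵢ(a,b).
--
-- Upper bound: among n points and lines, replace values by ranks below 2ᵏ, k ≈ log n.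
-- Colour a pair by the first binary digit in which its two ranks differ (for each i).
-- There are (2k+1)ᴺ colours, each determines the comparisons, and each colour class
-- is a disjoint union of complete bipartite graphs. As two lines meet at most once,
-- the incidences of one colour form stars, so there are at most (2k+1)ᴺ n incidences.
--
-- Lower bound: let A be the set of subset sums of g₁,…,g_r, all 2ʳ of them distinct,
-- and B_t = {Σ cᵢⱼ gᵢ gⱼ : 0 ≤ cᵢⱼ ≤ t}. For some t < 2ʳ, |B_{t+1}| ≤ 2|B_t|. Since
-- A·A + B_t ⊆ B_{t+1}, the points A × B_{t+1} and the lines A × B_t have |A|²|B_t|
-- incidences, at least 2ʳ/3 times the number of points and lines, while
-- k is polynomial in r.

module Submission where

open import Defs
open import Relation.Nullary using (¬_; Dec; yes; no; contradiction)
open import Relation.Nullary.Decidable using (¬?; _×-dec_)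
open import Relation.Binary.Definitions using (DecidableEquality; Decidable; Transitive; Tri; tri<; tri≈; tri>)
open import Relation.Binary.PropositionalEquality
open import Relation.Binary.Structures using (IsStrictTotalOrder)
open import Algebra.Bundles using (AbelianGroup; CommutativeRing; Ring)
import Algebra.Properties.AbelianGroup
import Algebra.Properties.CommutativeSemigroup
import Algebra.Properties.Ring
import Algebra.Properties.Semiring.Mult
import Algebra.Properties.Semiring.Sum
open import Data.Empty using (⊥-elim)
open import Data.Fin using (Fin; zero; suc; toℕ; fromℕ<; combine; join; quotient; remainder; splitAt; finToFun; funToFin)
import Data.Fin.Properties as Finₚ
open import Data.List as List using (List; []; _∷_; cartesianProductWith)
open import Data.List.Membership.Propositional using (_∈_)
open import Data.List.Membership.Propositional.Properties using (∈-cartesianProductWith⁺; ∈-map⁺; ∈-map⁻)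
open import Data.List.Relation.Unary.All as All using (All; []; _∷_)
import Data.List.Relation.Unary.All.Properties as Allₚ
open import Data.List.Relation.Unary.Any using (here; there)
open import Data.Nat as ℕ using (ℕ; zero; suc; s≤s; z≤n)
import Data.Nat.Properties as ℕₚ
open import Data.Nat.Tactic.RingSolver using (solve-∀)
open import Data.Product as Product using (Σ-syntax; _×_; ∃-syntax; _,_; proj₁; proj₂; uncurry)
open import Data.Sum as Sum using (_⊎_; inj₁; inj₂; [_,_]′)
open import Data.Sum.Properties using (inj₁-injective; inj₂-injective)
open import Data.Vec as Vec using (Vec; []; _∷_; lookup; zipWith)
import Data.Vec.Properties as Vecₚ
open import Function.Base using (_∘_; id)
open import Function.Bundles using (Equivalence)
open import Function.Definitions using (Injective)
open import Level using (0ℓ)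

-- Comparisons in linear orders, and their colourings

data Cmp : Set where
  lt eq gt : Cmp

flip : Cmp → Cmp
flip lt = gt
flip eq = eq
flip gt = lt

fromTri : {A B C : Set} → Tri A B C → Cmp
fromTri (tri< _ _ _) = lt
fromTri (tri≈ _ _ _) = eq
fromTri (tri> _ _ _) = gt

module Comparison {A : Set} {_<_ : A → A → Set} (isSTO : IsStrictTotalOrder _≡_ _<_) where
  open IsStrictTotalOrder isSTO using (compare; irrefl; _<?_) renaming (trans to <-trans)

  cmp : A → A → Cmp
  cmp x y = fromTri (compare x y)

  cmp-lt : ∀ {x y} → x < y → cmp x y ≡ lt
  cmp-lt {x} {y} x<y with compare x y
  ... | tri< _ _ _   = refl
  ... | tri≈ x≮y _ _ = contradiction x<y x≮y
  ... | tri> x≮y _ _ = contradiction x<y x≮y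

  cmp-eq : ∀ {x y} → x ≡ y → cmp x y ≡ eq
  cmp-eq {x} {y} x≡y with compare x y
  ... | tri< _ x≢y _ = contradiction x≡y x≢y
  ... | tri≈ _ _ _   = refl
  ... | tri> _ x≢y _ = contradiction x≡y x≢y

  cmp-gt : ∀ {x y} → y < x → cmp x y ≡ gt
  cmp-gt {x} {y} y<x with compare x y
  ... | tri< _ _ y≮x = contradiction y<x y≮x
  ... | tri≈ _ _ y≮x = contradiction y<x y≮x
  ... | tri> _ _ _   = refl

  cmp-lt⁻ : ∀ {x y} → cmp x y ≡ lt → x < y
  cmp-lt⁻ {x} {y} _ with compare x y
  cmp-lt⁻ _  | tri< x<y _ _ = x<y
  cmp-lt⁻ () | tri≈ _ _ _
  cmp-lt⁻ () | tri> _ _ _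

  cmp-eq⁻ : ∀ {x y} → cmp x y ≡ eq → x ≡ y
  cmp-eq⁻ {x} {y} _ with compare x y
  cmp-eq⁻ () | tri< _ _ _
  cmp-eq⁻ _  | tri≈ _ x≡y _ = x≡y
  cmp-eq⁻ () | tri> _ _ _

  below : ∀ {n} → (Fin n → A) → A → ℕ
  below {zero}  W v = 0
  below {suc n} W v with W zero <? v
  ... | yes _ = suc (below (W ∘ suc) v)
  ... | no  _ = below (W ∘ suc) v

  below-≤ : ∀ {n} (W : Fin n → A) v → below W v ℕ.≤ n
  below-≤ {zero}  W v = z≤n
  below-≤ {suc n} W v with W zero <? v
  ... | yes _ = s≤s (below-≤ (W ∘ suc) v)
  ... | no  _ = ℕₚ.m≤n⇒m≤1+n (below-≤ (W ∘ suc) v)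

  below-mono : ∀ {n} (W : Fin n → A) {v w} → v < w → below W v ℕ.≤ below W w
  below-mono {zero}  W v<w = z≤n
  below-mono {suc n} W {v} {w} v<w with W zero <? v | W zero <? w
  ... | yes _ | yes _ = s≤s (below-mono (W ∘ suc) v<w)
  ... | yes p | no ¬q = contradiction (<-trans p v<w) ¬q
  ... | no  _ | yes _ = ℕₚ.m≤n⇒m≤1+n (below-mono (W ∘ suc) v<w)
  ... | no  _ | no  _ = below-mono (W ∘ suc) v<w

  -- The entry `W i` is counted below `w` but not below itself. Hence ranks are strict at listed
  -- values, and comparisons of such values survive the passage to ranks.
  below-strict : ∀ {n} (W : Fin n → A) i {w} → W i < w → below W (W i) ℕ.< below W w
  below-strict {suc n} W zero {w} v<w with W zero <? W zero | W zero <? w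
  ... | yes p | _     = contradiction p (irrefl refl)
  ... | no  _ | yes _ = s≤s (below-mono (W ∘ suc) v<w)
  ... | no  _ | no ¬q = contradiction v<w ¬q
  below-strict {suc n} W (suc i) {w} v<w with W zero <? W (suc i) | W zero <? w
  ... | yes _ | yes _ = s≤s (below-strict (W ∘ suc) i v<w)
  ... | yes p | no ¬q = contradiction (<-trans p v<w) ¬q
  ... | no  _ | yes _ = ℕₚ.m≤n⇒m≤1+n (below-strict (W ∘ suc) i v<w)
  ... | no  _ | no  _ = below-strict (W ∘ suc) i v<w

module ℕC = Comparison ℕₚ.<-isStrictTotalOrder

module _ {A : Set} {_<_ : A → A → Set} (isSTO : IsStrictTotalOrder _≡_ _<_) where
  open Comparison isSTO
  open IsStrictTotalOrder isSTO using (compare)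

  cmp-below : ∀ {n} (W : Fin n → A) i j →
              ℕC.cmp (below W (W i)) (below W (W j)) ≡ cmp (W i) (W j)
  cmp-below W i j with compare (W i) (W j)
  ... | tri< a _ _ = ℕC.cmp-lt (below-strict W i a)
  ... | tri≈ _ e _ = ℕC.cmp-eq (cong (below W) e)
  ... | tri> _ _ a = ℕC.cmp-gt (below-strict W j a)

-- Two directions for each of `k` binary digits, and one code for equal numbers.
codes : ℕ → ℕ
codes zero    = 1
codes (suc k) = suc (suc (codes k))

-- For u, w < 2ᵏ: the position and direction of the first binary digit in which
-- u and w differ.
code : (k : ℕ) → ℕ → ℕ → Fin (codes k)
code zero    u w = zero
code (suc k) u w with u ℕ.<? 2 ℕ.^ k | w ℕ.<? 2 ℕ.^ k
... | yes _ | yes _ = suc (suc (code k u w))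
... | yes _ | no  _ = zero
... | no  _ | yes _ = suc zero
... | no  _ | no  _ = suc (suc (code k (u ℕ.∸ 2 ℕ.^ k) (w ℕ.∸ 2 ℕ.^ k)))

-- Three corners of one colour force the fourth, which says that each colour class is a disjoint
-- union of complete bipartite graphs.
Rectangular : {P L C : Set} → (P → L → C) → Set
Rectangular {P} {L} f = ∀ {p p′ : P} {l l′ : L} → f p′ l ≡ f p l → f p l′ ≡ f p l → f p′ l′ ≡ f p l

suc-suc-injective : ∀ {n} {i j : Fin n} → Fin.suc (Fin.suc i) ≡ suc (suc j) → i ≡ j
suc-suc-injective refl = refl

-- Equal codes put `u′` in the half of `u` and `w′` in the half of `w`. If these halves differ, the
-- code is already settled; otherwise the remaining digits decide by induction.
code-rectangular : ∀ k → Rectangular (code k)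
code-rectangular zero _ _ = refl
code-rectangular (suc k) {u} {u′} {w} {w′} e₁ e₂
  with u ℕ.<? 2 ℕ.^ k | u′ ℕ.<? 2 ℕ.^ k | w ℕ.<? 2 ℕ.^ k | w′ ℕ.<? 2 ℕ.^ k
... | yes _ | yes _ | yes _ | yes _ =
  cong (λ c → Fin.suc (Fin.suc c)) (code-rectangular k (suc-suc-injective e₁) (suc-suc-injective e₂))
... | yes _ | yes _ | no _  | no _  = refl
... | no _  | no _  | yes _ | yes _ = refl
... | no _  | no _  | no _  | no _  =
  cong (λ c → Fin.suc (Fin.suc c)) (code-rectangular k (suc-suc-injective e₁) (suc-suc-injective e₂))
code-rectangular (suc k) e₁ () | yes _ | yes _ | yes _ | no _
code-rectangular (suc k) e₁ () | yes _ | yes _ | no _ | yes _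
code-rectangular (suc k) () e₂ | yes _ | no _ | yes _ | _
code-rectangular (suc k) () e₂ | yes _ | no _ | no _ | _
code-rectangular (suc k) () e₂ | no _ | yes _ | yes _ | _
code-rectangular (suc k) () e₂ | no _ | yes _ | no _ | _
code-rectangular (suc k) e₁ () | no _ | no _ | yes _ | no _
code-rectangular (suc k) e₁ () | no _ | no _ | no _ | yes _

decode : ∀ k → Fin (codes k) → Cmp
decode zero    _             = eq
decode (suc k) zero          = lt
decode (suc k) (suc zero)    = gt
decode (suc k) (suc (suc c)) = decode k c

cmp-+ : ∀ b u w → ℕC.cmp (b ℕ.+ u) (b ℕ.+ w) ≡ ℕC.cmp u w
cmp-+ b u w with ℕₚ.<-cmp u w
... | tri< a _ _ = ℕC.cmp-lt (ℕₚ.+-monoʳ-< b a)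
... | tri≈ _ e _ = ℕC.cmp-eq (cong (b ℕ.+_) e)
... | tri> _ _ a = ℕC.cmp-gt (ℕₚ.+-monoʳ-< b a)

∸-<2^ : ∀ k {u} → ¬ (u ℕ.< 2 ℕ.^ k) → u ℕ.< 2 ℕ.^ suc k → u ℕ.∸ 2 ℕ.^ k ℕ.< 2 ℕ.^ k
∸-<2^ k {u} u≮ u< = ℕₚ.+-cancelˡ-< (2 ℕ.^ k) _ _
  (subst₂ ℕ._<_ (sym (ℕₚ.m+[n∸m]≡n (ℕₚ.≮⇒≥ u≮))) (cong (2 ℕ.^ k ℕ.+_) (ℕₚ.+-identityʳ _)) u<)

cmp-decode : ∀ k {u w} → u ℕ.< 2 ℕ.^ k → w ℕ.< 2 ℕ.^ k → ℕC.cmp u w ≡ decode k (code k u w)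
cmp-decode zero (s≤s z≤n) (s≤s z≤n) = refl
cmp-decode (suc k) {u} {w} u< w< with u ℕ.<? 2 ℕ.^ k | w ℕ.<? 2 ℕ.^ k
... | yes p | yes q = cmp-decode k p q
... | yes p | no ¬q = ℕC.cmp-lt (ℕₚ.<-≤-trans p (ℕₚ.≮⇒≥ ¬q))
... | no ¬p | yes q = ℕC.cmp-gt (ℕₚ.<-≤-trans q (ℕₚ.≮⇒≥ ¬p))
... | no ¬p | no ¬q = begin
  ℕC.cmp u w
    ≡⟨ cong₂ ℕC.cmp (ℕₚ.m+[n∸m]≡n (ℕₚ.≮⇒≥ ¬p)) (ℕₚ.m+[n∸m]≡n (ℕₚ.≮⇒≥ ¬q)) ⟨
  ℕC.cmp (2 ℕ.^ k ℕ.+ (u ℕ.∸ 2 ℕ.^ k)) (2 ℕ.^ k ℕ.+ (w ℕ.∸ 2 ℕ.^ k))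
    ≡⟨ cmp-+ (2 ℕ.^ k) _ _ ⟩
  ℕC.cmp (u ℕ.∸ 2 ℕ.^ k) (w ℕ.∸ 2 ℕ.^ k)
    ≡⟨ cmp-decode k (∸-<2^ k ¬p u<) (∸-<2^ k ¬q w<) ⟩
  decode k (code k (u ℕ.∸ 2 ℕ.^ k) (w ℕ.∸ 2 ℕ.^ k)) ∎
  where open ≡-Reasoning

-- The relation `S` is kept general: it is agreement of comparisons when a colouring is built, and
-- transfer of incidence when edges are counted.
record RectangularColouring {P L : Set} (q : ℕ) (S : P → L → P → L → Set) : Set where
  field
    colour      : P → L → Fin q
    rectangular : Rectangular colour
    refines     : ∀ {p l p′ l′} → colour p l ≡ colour p′ l′ → S p l p′ l′

module _ {A : Set} {_<_ : A → A → Set} (isSTO : IsStrictTotalOrder _≡_ _<_) where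
  open Comparison isSTO

  SameCmp : {P L : Set} → (P → A) × (L → A) → P → L → P → L → Set
  SameCmp (u , w) p l p′ l′ = cmp (u p) (w l) ≡ cmp (u p′) (w l′)

  -- Ranks preserve all comparisons between the finitely many values involved. They run from `0` to
  -- `n₁ + n₂` inclusive, hence the strict bound by `2 ^ k`.
  comparison-colouring : ∀ k {n₁ n₂} (u : Fin n₁ → A) (w : Fin n₂ → A) →
    n₁ ℕ.+ n₂ ℕ.< 2 ℕ.^ k → RectangularColouring (codes k) (SameCmp (u , w))
  comparison-colouring k {n₁} {n₂} u w n< = record
    { colour      = λ p l → code k (rank (u p)) (rank (w l))
    ; rectangular = code-rectangular k
    ; refines     = λ {p} {l} {p′} {l′} e →
        trans (cmp-code p l) (trans (cong (decode k) e) (sym (cmp-code p′ l′)))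
    }
    where
    -- Points and lines are ranked in one common list, because their values are compared with each
    -- other.
    W : Fin (n₁ ℕ.+ n₂) → A
    W i = [ u , w ]′ (splitAt n₁ i)

    rank : A → ℕ
    rank = below W

    rank< : ∀ v → rank v ℕ.< 2 ℕ.^ k
    rank< v = ℕₚ.≤-<-trans (below-≤ W v) n<

    cmp-code : ∀ p l → cmp (u p) (w l) ≡ decode k (code k (rank (u p)) (rank (w l)))
    cmp-code p l = begin
      cmp (u p) (w l)                     ≡⟨ cong₂ cmp Wp Wl ⟨
      cmp (W i) (W j)                     ≡⟨ cmp-below isSTO W i j ⟨
      ℕC.cmp (rank (W i)) (rank (W j))    ≡⟨ cong₂ (λ x y → ℕC.cmp (rank x) (rank y)) Wp Wl ⟩
      ℕC.cmp (rank (u p)) (rank (w l))    ≡⟨ cmp-decode k (rank< _) (rank< _) ⟩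
      decode k (code k (rank (u p)) (rank (w l))) ∎
      where
      open ≡-Reasoning
      i = join n₁ n₂ (inj₁ p)
      j = join n₁ n₂ (inj₂ l)
      Wp : W i ≡ u p
      Wp = cong [ u , w ]′ (Finₚ.splitAt-join n₁ n₂ (inj₁ p))
      Wl : W j ≡ w l
      Wl = cong [ u , w ]′ (Finₚ.splitAt-join n₁ n₂ (inj₂ l))

  AllSameCmp : {P L : Set} → List ((P → A) × (L → A)) → P → L → P → L → Set
  AllSameCmp Q p l p′ l′ = All (λ uw → SameCmp uw p l p′ l′) Q

  -- The colours of the separate comparisons form a tuple, and rectangularity holds coordinatewise.
  comparisons-colouring : ∀ k {P L : Set} (Q : List ((P → A) × (L → A)))
    {n₁ n₂} (pt : Fin n₁ → P) (ln : Fin n₂ → L) → n₁ ℕ.+ n₂ ℕ.< 2 ℕ.^ k →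
    RectangularColouring (codes k ℕ.^ List.length Q)
      (λ i j i′ j′ → AllSameCmp Q (pt i) (ln j) (pt i′) (ln j′))
  comparisons-colouring k []            pt ln n< = record
    { colour = λ _ _ → zero ; rectangular = λ _ _ → refl ; refines = λ _ → [] }
  comparisons-colouring k ((u , w) ∷ Q) pt ln n< = record
    { colour      = λ i j → combine (C.colour i j) (D.colour i j)
    ; rectangular = λ e₁ e₂ → cong₂ combine
        (C.rectangular (Finₚ.combine-injectiveˡ {m = codes k} _ _ _ _ e₁) (Finₚ.combine-injectiveˡ {m = codes k} _ _ _ _ e₂))
        (D.rectangular (Finₚ.combine-injectiveʳ {m = codes k} _ _ _ _ e₁) (Finₚ.combine-injectiveʳ {m = codes k} _ _ _ _ e₂))
    ; refines     = λ e → C.refines (Finₚ.combine-injectiveˡ {m = codes k} _ _ _ _ e)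
                        ∷ D.refines (Finₚ.combine-injectiveʳ {m = codes k} _ _ _ _ e)
    }
    where
    module C = RectangularColouring (comparison-colouring k (u ∘ pt) (w ∘ ln) n<)
    module D = RectangularColouring (comparisons-colouring k Q pt ln n<)

-- A rectangular colour class without K₂,₂ is a disjoint union of stars, so each
-- of its edges is the only one at its point or the only one at its line.
K₂₂-free-bound : ∀ {q n₁ n₂ e} (I : Fin n₁ → Fin n₂ → Set) →
  RectangularColouring q (λ p l p′ l′ → I p l → I p′ l′) →
  (∀ {p p′ l l′} → I p l → I p′ l → I p l′ → I p′ l′ → p ≡ p′ ⊎ l ≡ l′) →
  (edge : Fin e → Fin n₁ × Fin n₂) → Injective _≡_ _≡_ edge →
  (∀ i → I (proj₁ (edge i)) (proj₂ (edge i))) →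
  e ℕ.≤ q ℕ.* (n₁ ℕ.+ n₂)
K₂₂-free-bound {q} {n₁} {n₂} {e} I χ K₂₂-free edge edge-injective incident =
  Finₚ.injective⇒≤ {f = label} label-injective
  where
  open RectangularColouring χ
  pt : Fin e → Fin n₁
  pt i = proj₁ (edge i)
  ln : Fin e → Fin n₂
  ln i = proj₂ (edge i)
  col : Fin e → Fin q
  col i = colour (pt i) (ln i)

  Branches : Fin e → Set
  Branches i = ∃[ j ] (col j ≡ col i × pt j ≡ pt i × ¬ (ln j ≡ ln i))

  branches? : ∀ i → Dec (Branches i)
  branches? i = Finₚ.any? λ j → (col j Finₚ.≟ col i) ×-dec ((pt j Finₚ.≟ pt i) ×-dec ¬? (ln j Finₚ.≟ ln i))

  endpoint : ∀ i → Dec (Branches i) → Fin n₁ ⊎ Fin n₂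
  endpoint i (yes _) = inj₂ (ln i)
  endpoint i (no _)  = inj₁ (pt i)

  label : Fin e → Fin (q ℕ.* (n₁ ℕ.+ n₂))
  label i = combine (col i) (join n₁ n₂ (endpoint i (branches? i)))

  join-injective : ∀ {x y} → join n₁ n₂ x ≡ join n₁ n₂ y → x ≡ y
  join-injective {x} {y} same = trans (sym (Finₚ.splitAt-join n₁ n₂ x))
    (trans (cong (splitAt n₁) same) (Finₚ.splitAt-join n₁ n₂ y))

  same-endpoint : ∀ {i i′} (d : Dec (Branches i)) (d′ : Dec (Branches i′)) → col i ≡ col i′ →
                  endpoint i d ≡ endpoint i′ d′ → edge i ≡ edge i′
  same-endpoint {i} {i′} (no ¬b) (no _) c same with ln i′ Finₚ.≟ ln i
  ... | yes l≡ = cong₂ _,_ (inj₁-injective same) (sym l≡)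
  ... | no  l≢ = contradiction (i′ , sym c , sym (inj₁-injective same) , l≢) ¬b
  -- The branch `j` at the point of `i` and the edge `i′` at the line of `i` have one colour, so the
  -- fourth corner `(pt i′ , ln j)` has it too and is an incidence. As `ln j` differs from `ln i`,
  -- the absence of K₂,₂ identifies the two points.
  same-endpoint {i} {i′} (yes (j , cj , pj , lj≢)) (yes _) c same =
    [ (λ p≡ → cong₂ _,_ p≡ l≡) , (λ l≡′ → contradiction (sym l≡′) lj≢) ]′
      (K₂₂-free (incident i) (subst (I (pt i′)) (sym l≡) (incident i′))
        (subst (λ p → I p (ln j)) pj (incident j))
        (refines (trans cj (sym corner)) (incident j)))
    where
    l≡ : ln i ≡ ln i′
    l≡ = inj₂-injective same
    corner : colour (pt i′) (ln j) ≡ col i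
    corner = rectangular (trans (cong (colour (pt i′)) l≡) (sym c))
                         (trans (cong (λ p → colour p (ln j)) (sym pj)) cj)

  label-injective : Injective _≡_ _≡_ label
  label-injective {i} {i′} same = edge-injective (same-endpoint (branches? i) (branches? i′)
    (Finₚ.combine-injectiveˡ {m = q} _ _ _ _ same)
    (join-injective (Finₚ.combine-injectiveʳ {m = q} _ _ _ _ same)))

-- Numerical estimates and the choice of sizes

n<2^n : ∀ n → n ℕ.< 2 ℕ.^ n
n<2^n zero    = s≤s z≤n
n<2^n (suc n) = ℕₚ.≤-trans (ℕₚ.+-mono-≤ (ℕₚ.m^n>0 2 n) (n<2^n n))
  (ℕₚ.≤-reflexive (cong (2 ℕ.^ n ℕ.+_) (sym (ℕₚ.+-identityʳ _))))

codes≡ : ∀ k → codes k ≡ 1 ℕ.+ 2 ℕ.* k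
codes≡ zero    = refl
codes≡ (suc k) = trans (cong (2 ℕ.+_) (codes≡ k)) (cong suc (sym (ℕₚ.*-suc 2 k)))

-- For `r = 2 ^ (4 * M)` the power `r ^ M` equals `2 ^ (4 * M * M)`, and `4 * M * M` is the square
-- of `2 * M`, hence less than the square of `2 ^ (2 * M)`, which is `r`. The equation for `r` is
-- returned because `r` must also be bounded from below.
power<2^ : ∀ M → ∃[ r ] (2 ℕ.^ (4 ℕ.* M) ≡ r × r ℕ.^ M ℕ.< 2 ℕ.^ r)
power<2^ M = r , refl , (begin-strict
  r ℕ.^ M                 ≡⟨ ℕₚ.^-*-assoc 2 (4 ℕ.* M) M ⟩
  2 ℕ.^ (4 ℕ.* M ℕ.* M)   <⟨ ℕₚ.^-monoʳ-< 2 (s≤s (s≤s z≤n)) 4MM<r ⟩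
  2 ℕ.^ r                 ∎)
  where
  open ℕₚ.≤-Reasoning
  r = 2 ℕ.^ (4 ℕ.* M)
  square : ∀ M → 4 ℕ.* M ℕ.* M ≡ (2 ℕ.* M) ℕ.* (2 ℕ.* M)
  square = solve-∀
  double : ∀ M → 2 ℕ.* M ℕ.+ 2 ℕ.* M ≡ 4 ℕ.* M
  double = solve-∀
  4MM<r : 4 ℕ.* M ℕ.* M ℕ.< r
  4MM<r = begin-strict
    4 ℕ.* M ℕ.* M                       ≡⟨ square M ⟩
    (2 ℕ.* M) ℕ.* (2 ℕ.* M)             <⟨ ℕₚ.*-mono-< (n<2^n (2 ℕ.* M)) (n<2^n (2 ℕ.* M)) ⟩
    2 ℕ.^ (2 ℕ.* M) ℕ.* 2 ℕ.^ (2 ℕ.* M) ≡⟨ ℕₚ.^-distribˡ-+-* 2 (2 ℕ.* M) (2 ℕ.* M) ⟨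
    2 ℕ.^ (2 ℕ.* M ℕ.+ 2 ℕ.* M)         ≡⟨ cong (2 ℕ.^_) (double M) ⟩
    r ∎

-- 2ʳ is the size of A, the box B_t for t = 2ʳ has at most (2ʳ+1)^(r²) elements, and
-- 2ᵏ exceeds the number of points and lines.
record Sizes (N : ℕ) : Set where
  field
    r k   : ℕ
    few   : suc (2 ℕ.^ r) ℕ.^ (r ℕ.* r) ℕ.< 2 ℕ.^ (2 ℕ.^ r)
    room  : 3 ℕ.* (2 ℕ.^ r ℕ.* suc (2 ℕ.^ r) ℕ.^ (r ℕ.* r)) ℕ.< 2 ℕ.^ k
    gain  : 3 ℕ.* codes k ℕ.^ N ℕ.< 2 ℕ.^ r

-- Since `suc (2 ^ r) ≤ 2 ^ suc r`, a cubic polynomial in `r` suffices for `k`, and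
-- `codes k ≤ r ^ 4`. Then `3 * codes k ^ N ≤ r ^ (4 * suc N)`, which explains the exponent passed
-- to `power<2^`.
sizes : ∀ N → Sizes N
sizes N with power<2^ (4 ℕ.* suc N)
... | r , r≡ , r^M<2^r = record
  { r = r ; k = k
  ; few  = begin-strict
      suc (2 ℕ.^ r) ℕ.^ (r ℕ.* r)  ≤⟨ span≤ ⟩
      2 ℕ.^ (suc r ℕ.* (r ℕ.* r))  <⟨ ℕₚ.^-monoʳ-< 2 (s≤s (s≤s z≤n)) exponent< ⟩
      2 ℕ.^ (2 ℕ.^ r)              ∎
  ; room = begin-strict
      3 ℕ.* (2 ℕ.^ r ℕ.* suc (2 ℕ.^ r) ℕ.^ (r ℕ.* r))
        ≤⟨ ℕₚ.*-monoʳ-≤ 3 (ℕₚ.*-monoʳ-≤ (2 ℕ.^ r) span≤) ⟩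
      3 ℕ.* (2 ℕ.^ r ℕ.* 2 ℕ.^ (suc r ℕ.* (r ℕ.* r)))
        ≡⟨ cong (3 ℕ.*_) (ℕₚ.^-distribˡ-+-* 2 r (suc r ℕ.* (r ℕ.* r))) ⟨
      3 ℕ.* 2 ℕ.^ (r ℕ.+ suc r ℕ.* (r ℕ.* r))
        <⟨ ℕₚ.*-monoˡ-< (2 ℕ.^ (r ℕ.+ suc r ℕ.* (r ℕ.* r))) {{ℕₚ.m^n≢0 2 (r ℕ.+ suc r ℕ.* (r ℕ.* r))}} {3} {4} ℕₚ.≤-refl ⟩
      4 ℕ.* 2 ℕ.^ (r ℕ.+ suc r ℕ.* (r ℕ.* r))
        ≡⟨ ℕₚ.^-distribˡ-+-* 2 2 (r ℕ.+ suc r ℕ.* (r ℕ.* r)) ⟨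
      2 ℕ.^ k ∎
  ; gain = begin-strict
      3 ℕ.* codes k ℕ.^ N   ≤⟨ ℕₚ.*-mono-≤ 3≤X (ℕₚ.^-monoˡ-≤ N codes≤X) ⟩
      X ℕ.* X ℕ.^ N         ≡⟨ ℕₚ.^-*-assoc r 4 (suc N) ⟩
      r ℕ.^ (4 ℕ.* suc N)   <⟨ r^M<2^r ⟩
      2 ℕ.^ r               ∎
  }
  where
  open ℕₚ.≤-Reasoning
  k X : ℕ
  -- The summand `2` absorbs the factor `3 < 2 ^ 2` in `room`.
  k = 2 ℕ.+ (r ℕ.+ suc r ℕ.* (r ℕ.* r))
  X = r ℕ.^ 4

  8≤r : 8 ℕ.≤ r
  8≤r = subst (8 ℕ.≤_) r≡ (ℕₚ.^-monoʳ-≤ 2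
    (ℕₚ.≤-trans (s≤s (s≤s (s≤s z≤n))) (ℕₚ.*-monoʳ-≤ 4 {1} {4 ℕ.* suc N} (s≤s z≤n))))

  instance
    r≢0 : ℕ.NonZero r
    r≢0 = ℕ.>-nonZero (ℕₚ.≤-trans (s≤s z≤n) 8≤r)

  r≤r³ : r ℕ.≤ r ℕ.^ 3
  r≤r³ = ℕₚ.≤-trans (ℕₚ.≤-reflexive (sym (ℕₚ.^-identityʳ r))) (ℕₚ.^-monoʳ-≤ r {1} {3} (s≤s z≤n))

  r²≤r³ : r ℕ.^ 2 ℕ.≤ r ℕ.^ 3
  r²≤r³ = ℕₚ.^-monoʳ-≤ r {2} {3} (s≤s (s≤s z≤n))

  5≤r³ : 5 ℕ.≤ r ℕ.^ 3
  5≤r³ = ℕₚ.≤-trans (ℕₚ.≤-trans (s≤s (s≤s (s≤s (s≤s (s≤s z≤n))))) 8≤r) r≤r³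

  codes≤X : codes k ℕ.≤ X
  codes≤X = begin
    codes k                                     ≡⟨ codes≡ k ⟩
    1 ℕ.+ 2 ℕ.* k                               ≡⟨ expand r ⟩
    5 ℕ.+ 2 ℕ.* r ℕ.+ (2 ℕ.* r ℕ.^ 2 ℕ.+ 2 ℕ.* r ℕ.^ 3)
      ≤⟨ ℕₚ.+-mono-≤ (ℕₚ.+-mono-≤ 5≤r³ (ℕₚ.*-monoʳ-≤ 2 r≤r³)) (ℕₚ.+-monoˡ-≤ _ (ℕₚ.*-monoʳ-≤ 2 r²≤r³)) ⟩
    r ℕ.^ 3 ℕ.+ 2 ℕ.* r ℕ.^ 3 ℕ.+ (2 ℕ.* r ℕ.^ 3 ℕ.+ 2 ℕ.* r ℕ.^ 3) ≡⟨ collect (r ℕ.^ 3) ⟩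
    7 ℕ.* r ℕ.^ 3                               ≤⟨ ℕₚ.*-monoˡ-≤ (r ℕ.^ 3) (ℕₚ.≤-trans (ℕₚ.n≤1+n 7) 8≤r) ⟩
    X                                           ∎
    where
    expand : ∀ r → 1 ℕ.+ 2 ℕ.* (2 ℕ.+ (r ℕ.+ suc r ℕ.* (r ℕ.* r)))
                 ≡ 5 ℕ.+ 2 ℕ.* r ℕ.+ (2 ℕ.* (r ℕ.* (r ℕ.* 1)) ℕ.+ 2 ℕ.* (r ℕ.* (r ℕ.* (r ℕ.* 1))))
    expand = solve-∀
    collect : ∀ x → x ℕ.+ 2 ℕ.* x ℕ.+ (2 ℕ.* x ℕ.+ 2 ℕ.* x) ≡ 7 ℕ.* x
    collect = solve-∀

  3≤X : 3 ℕ.≤ X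
  3≤X = ℕₚ.≤-trans (s≤s (s≤s (s≤s z≤n))) (ℕₚ.≤-trans 8≤r
    (ℕₚ.≤-trans (ℕₚ.≤-reflexive (sym (ℕₚ.^-identityʳ r))) (ℕₚ.^-monoʳ-≤ r {1} {4} (s≤s z≤n))))

  k≤codes : k ℕ.≤ codes k
  k≤codes = ℕₚ.≤-trans (ℕₚ.≤-trans (ℕₚ.m≤n*m k 2) (ℕₚ.n≤1+n (2 ℕ.* k))) (ℕₚ.≤-reflexive (sym (codes≡ k)))

  exponent< : suc r ℕ.* (r ℕ.* r) ℕ.< 2 ℕ.^ r
  exponent< = begin-strict
    suc r ℕ.* (r ℕ.* r)   ≤⟨ ℕₚ.m≤n⇒m≤o+n 2 (ℕₚ.m≤n+m _ r) ⟩
    k                     ≤⟨ k≤codes ⟩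
    codes k               ≤⟨ codes≤X ⟩
    X                     ≤⟨ ℕₚ.^-monoʳ-≤ r (ℕₚ.*-monoʳ-≤ 4 {1} {suc N} (s≤s z≤n)) ⟩
    r ℕ.^ (4 ℕ.* suc N)   <⟨ r^M<2^r ⟩
    2 ℕ.^ r               ∎

  span≤ : suc (2 ℕ.^ r) ℕ.^ (r ℕ.* r) ℕ.≤ 2 ℕ.^ (suc r ℕ.* (r ℕ.* r))
  span≤ = begin
    suc (2 ℕ.^ r) ℕ.^ (r ℕ.* r)     ≤⟨ ℕₚ.^-monoˡ-≤ (r ℕ.* r) suc≤ ⟩
    (2 ℕ.^ suc r) ℕ.^ (r ℕ.* r)     ≡⟨ ℕₚ.^-*-assoc 2 (suc r) (r ℕ.* r) ⟩
    2 ℕ.^ (suc r ℕ.* (r ℕ.* r))     ∎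
    where
    suc≤ : suc (2 ℕ.^ r) ℕ.≤ 2 ℕ.^ suc r
    suc≤ = ℕₚ.+-mono-≤ (ℕₚ.m^n>0 2 r) (ℕₚ.m≤m+n (2 ℕ.^ r) 0)

-- A sequence with a positive start that more than doubles at each of `K` steps would reach `2 ^ K`.
-- The search runs downwards to a step where the sequence drops below the powers of two.
slow-step : ∀ (n : ℕ → ℕ) K → 0 ℕ.< n 0 → n K ℕ.< 2 ℕ.^ K →
            ∃[ i ] (i ℕ.< K × n (suc i) ℕ.≤ 2 ℕ.* n i)
slow-step n zero n₀>0 nK< = contradiction (ℕₚ.<-≤-trans nK< n₀>0) (ℕₚ.<-irrefl refl)
slow-step n (suc K) n₀>0 nK< with n K ℕ.<? 2 ℕ.^ K
... | yes p with slow-step n K n₀>0 p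
...   | i , i<K , step = i , ℕₚ.m≤n⇒m≤1+n i<K , step
slow-step n (suc K) n₀>0 nK< | no ¬p =
  K , ℕₚ.≤-refl , ℕₚ.<⇒≤ (ℕₚ.<-≤-trans nK< (ℕₚ.*-monoʳ-≤ 2 (ℕₚ.≮⇒≥ ¬p)))

-- Dense incidence configurations in infinite fields

-- Different coefficients can give the same field element, so a box is listed without repetition
-- before its elements are counted.
record Deduplication {A : Set} {m} (f : Fin m → A) : Set where
  field
    size      : ℕ
    element   : Fin size → A
    size≤     : size ℕ.≤ m
    injective : Injective _≡_ _≡_ element
    covers    : ∀ i → ∃[ j ] element j ≡ f i
    within    : ∀ j → ∃[ i ] element j ≡ f i

deduplicate : {A : Set} → DecidableEquality A → ∀ {m} (f : Fin m → A) → Deduplication f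
deduplicate _≟_ {zero} f = record
  { size = 0 ; element = λ () ; size≤ = z≤n ; injective = λ { {()} } ; covers = λ () ; within = λ () }
deduplicate {A} _≟_ {suc m} f with deduplicate _≟_ (f ∘ suc)
... | rest with Finₚ.any? (λ j → Deduplication.element rest j ≟ f zero)
...   | yes hit = record
  { size = size ; element = element ; size≤ = ℕₚ.m≤n⇒m≤1+n size≤ ; injective = injective
  ; covers = λ { zero → hit ; (suc i) → covers i }
  ; within = λ j → Product.map suc id (within j)
  }
  where open Deduplication rest
...   | no miss = record
  { size = suc size ; element = element⁺ ; size≤ = s≤s size≤ ; injective = injective⁺
  ; covers = λ { zero → zero , refl ; (suc i) → Product.map suc id (covers i) }
  ; within = λ { zero → zero , refl ; (suc j) → Product.map suc id (within j) }
  }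
  where
  open Deduplication rest
  element⁺ : Fin (suc size) → A
  element⁺ zero    = f zero
  element⁺ (suc j) = element j
  injective⁺ : Injective _≡_ _≡_ element⁺
  injective⁺ {zero}  {zero}  _ = refl
  injective⁺ {zero}  {suc j} e = contradiction (j , sym e) miss
  injective⁺ {suc i} {zero}  e = contradiction (i , e) miss
  injective⁺ {suc i} {suc j} e = cong suc (injective e)

remQuot-injective : ∀ {m} n {i j : Fin (m ℕ.* n)} → quotient {m} n i ≡ quotient n j →
                    remainder {m} n i ≡ remainder {m} n j → i ≡ j
remQuot-injective {m} n {i} {j} q≡ r≡ = trans (sym (Finₚ.combine-remQuot {m} n i))
  (trans (cong₂ combine q≡ r≡) (Finₚ.combine-remQuot {m} n j))

module FieldConfigurations (F : Field) (_≟_ : DecidableEquality (Field.Carrier F)) where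
  open Field F using (isCommutativeRing; inverse)

  R : CommutativeRing 0ℓ 0ℓ
  R = record { isCommutativeRing = isCommutativeRing }

  open CommutativeRing R public using () renaming (Carrier to K)
  open CommutativeRing R using (_+_; _*_; -_; 0#; 1#; ring; semiring; +-abelianGroup;
    +-assoc; +-comm; +-identityˡ; +-identityʳ; -‿inverseʳ;
    *-assoc; *-comm; *-identityʳ; distribˡ; distribʳ; zeroˡ)
  open Algebra.Properties.Ring ring using (-‿distribˡ-*; -‿distribʳ-*)
  open Algebra.Properties.AbelianGroup +-abelianGroup
    using (x∙y⁻¹≈ε⇒x≈y; x≈y⇒x∙y⁻¹≈ε; ∙-cancelˡ; ⁻¹-∙-comm)
  open Algebra.Properties.Semiring.Sum semiring using (sum; ∑-distrib-+; sum-cong-≗; *-distribˡ-sum; *-distribʳ-sum)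
  open Algebra.Properties.Semiring.Mult semiring using (×-comm-*; ×-assoc-*; ×-assocˡ; ×-homo-+) renaming (_×_ to _×ℕ_)

  no-zero-divisors : ∀ {x y} → x * y ≡ 0# → ¬ (x ≡ 0#) → y ≡ 0#
  no-zero-divisors {x} {y} xy≡0 x≢0 with inverse x x≢0
  ... | x⁻¹ , xx⁻¹≡1 = begin
    y              ≡⟨ *-identityʳ y ⟨
    y * 1#         ≡⟨ cong (y *_) xx⁻¹≡1 ⟨
    y * (x * x⁻¹)  ≡⟨ *-assoc y x x⁻¹ ⟨
    (y * x) * x⁻¹  ≡⟨ cong (_* x⁻¹) (trans (*-comm y x) xy≡0) ⟩
    0# * x⁻¹       ≡⟨ zeroˡ x⁻¹ ⟩
    0#             ∎
    where open ≡-Reasoning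

  -- Subtracting the equations of one line at the two points gives `(x - x′) a = y - y′`, and
  -- likewise for `a′`. If `x ≠ x′`, the factor `x - x′` cancels.
  two-lines-meet-once : ∀ {x x′ y y′ a a′ b b′} →
    y ≡ (a * x) + b → y′ ≡ (a * x′) + b → y ≡ (a′ * x) + b′ → y′ ≡ (a′ * x′) + b′ →
    (x ≡ x′ × y ≡ y′) ⊎ (a ≡ a′ × b ≡ b′)
  two-lines-meet-once {x} {x′} {y} {y′} {a} {a′} {b} {b′} e₁ e₂ e₃ e₄ with x ≟ x′
  ... | yes refl = inj₁ (refl , trans e₁ (sym e₂))
  ... | no x≢x′  = inj₂ (a≡a′ , ∙-cancelˡ (a * x) b b′
      (trans (sym e₁) (trans e₃ (cong (λ c → (c * x) + b′) (sym a≡a′)))))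
    where
    open ≡-Reasoning
    slope : ∀ {a b} → y ≡ (a * x) + b → y′ ≡ (a * x′) + b → (x + (- x′)) * a ≡ y + (- y′)
    slope {a} {b} p q = begin
      (x + (- x′)) * a                          ≡⟨ distribʳ a x (- x′) ⟩
      (x * a) + ((- x′) * a)                    ≡⟨ cong₂ _+_ (*-comm x a) (sym (-‿distribˡ-* x′ a)) ⟩
      (a * x) + (- (x′ * a))                    ≡⟨ cong₂ (λ u v → u + (- v)) (rest p) (trans (*-comm x′ a) (rest q)) ⟩
      (y + (- b)) + (- (y′ + (- b)))            ≡⟨ cancel ⟩
      y + (- y′)                                ∎
      where
      rest : ∀ {u v} → u ≡ v + b → v ≡ u + (- b)
      rest {u} {v} e = begin
        v               ≡⟨ +-identityʳ v ⟨
        v + 0#          ≡⟨ cong (v +_) (-‿inverseʳ b) ⟨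
        v + (b + (- b)) ≡⟨ +-assoc v b (- b) ⟨
        (v + b) + (- b) ≡⟨ cong (_+ (- b)) e ⟨
        u + (- b)       ∎
      cancel : (y + (- b)) + (- (y′ + (- b))) ≡ y + (- y′)
      cancel = begin
        (y + (- b)) + (- (y′ + (- b)))     ≡⟨ cong ((y + (- b)) +_) (⁻¹-∙-comm y′ (- b)) ⟨
        (y + (- b)) + ((- y′) + (- (- b))) ≡⟨ cong ((y + (- b)) +_) (+-comm (- y′) (- (- b))) ⟩
        (y + (- b)) + ((- (- b)) + (- y′)) ≡⟨ +-assoc y (- b) _ ⟩
        y + ((- b) + ((- (- b)) + (- y′))) ≡⟨ cong (y +_) (+-assoc (- b) (- (- b)) (- y′)) ⟨
        y + (((- b) + (- (- b))) + (- y′)) ≡⟨ cong (λ z → y + (z + (- y′))) (-‿inverseʳ (- b)) ⟩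
        y + (0# + (- y′))                  ≡⟨ cong (y +_) (+-identityˡ (- y′)) ⟩
        y + (- y′)                         ∎
    a≡a′ : a ≡ a′
    a≡a′ = x∙y⁻¹≈ε⇒x≈y a a′ (no-zero-divisors difference (x≢x′ ∘ x∙y⁻¹≈ε⇒x≈y x x′))
      where
      difference : (x + (- x′)) * (a + (- a′)) ≡ 0#
      difference = begin
        (x + (- x′)) * (a + (- a′))                   ≡⟨ distribˡ _ a (- a′) ⟩
        ((x + (- x′)) * a) + ((x + (- x′)) * (- a′))  ≡⟨ cong (((x + (- x′)) * a) +_) (-‿distribʳ-* (x + (- x′)) a′) ⟨
        ((x + (- x′)) * a) + (- ((x + (- x′)) * a′))  ≡⟨ x≈y⇒x∙y⁻¹≈ε (trans (slope e₁ e₂) (sym (slope e₃ e₄))) ⟩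
        0#                                            ∎

  -- The `r` binary digits of the index `s` say which generators belong to the subset.
  subset-sum : ∀ {r} → (Fin r → K) → Fin (2 ℕ.^ r) → K
  subset-sum g s = sum (λ i → toℕ (finToFun s i) ×ℕ g i)

  -- Infinity is a negative hypothesis, so a new element is obtained only up to double negation.
  -- This suffices, because the final goal is a negation.
  fresh : Infinite K → ∀ {m} (f : Fin m → K) → ¬ ¬ (∃[ x ] (∀ i → ¬ (f i ≡ x)))
  fresh infinite {m} f none = infinite (m , f , surjective)
    where
    surjective : ∀ y → ∃[ i ] (∀ {z} → z ≡ i → f z ≡ y)
    surjective y with Finₚ.any? (λ i → f i ≟ y)
    ... | yes (i , e) = i , λ { refl → e }
    ... | no missed   = ⊥-elim (none (y , λ i e → missed (i , e)))

  -- A new generator is taken outside the finite set of differences of old subset sums.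
  distinct-subset-sums : Infinite K → ∀ r →
    ¬ ¬ (Σ[ g ∈ (Fin r → K) ] Injective _≡_ _≡_ (subset-sum g))
  distinct-subset-sums infinite zero none = none ((λ ()) , λ { {zero} {zero} _ → refl })
  distinct-subset-sums infinite (suc r) none =
    distinct-subset-sums infinite r λ { (g , g-inj) →
      fresh infinite (differences g) λ { (x , x-new) → none (extend g x , extend-inj g g-inj x x-new) } }
    where
    n = 2 ℕ.^ r
    extend : (Fin r → K) → K → Fin (suc r) → K
    extend g x zero    = x
    extend g x (suc i) = g i

    differences : (Fin r → K) → Fin (n ℕ.* n) → K
    differences g s = subset-sum g (quotient n s) + (- subset-sum g (remainder {n} n s))

    module _ (g : Fin r → K) (g-inj : Injective _≡_ _≡_ (subset-sum g))
             (x : K) (x-new : ∀ i → ¬ (differences g i ≡ x)) where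
      new : ∀ s t → ¬ ((1 ×ℕ x) + subset-sum g s ≡ (0 ×ℕ x) + subset-sum g t)
      new s t e = x-new (combine t s) (begin
        differences g (combine t s)         ≡⟨ cong (λ qr → subset-sum g (proj₁ qr) + (- subset-sum g (proj₂ qr)))
                                                    (Finₚ.remQuot-combine {n} {n} t s) ⟩
        S t + (- S s)                       ≡⟨ cong (_+ (- S s)) (+-identityˡ (S t)) ⟨
        ((0 ×ℕ x) + S t) + (- S s)          ≡⟨ cong (_+ (- S s)) e ⟨
        ((x + 0#) + S s) + (- S s)          ≡⟨ +-assoc (x + 0#) (S s) (- S s) ⟩
        (x + 0#) + (S s + (- S s))          ≡⟨ cong₂ _+_ (+-identityʳ x) (-‿inverseʳ (S s)) ⟩
        x + 0#                              ≡⟨ +-identityʳ x ⟩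
        x                                   ∎)
        where
        open ≡-Reasoning
        S = subset-sum g

      split : ∀ (a b : Fin 2) (s t : Fin n) →
              (toℕ a ×ℕ x) + subset-sum g s ≡ (toℕ b ×ℕ x) + subset-sum g t → a ≡ b × s ≡ t
      split zero       zero       s t e = refl , g-inj (∙-cancelˡ (0 ×ℕ x) _ _ e)
      split (suc zero) (suc zero) s t e = refl , g-inj (∙-cancelˡ (1 ×ℕ x) _ _ e)
      split (suc zero) zero       s t e = contradiction e (new s t)
      split zero       (suc zero) s t e = contradiction (sym e) (new t s)

      extend-inj : Injective _≡_ _≡_ (subset-sum (extend g x))
      extend-inj {s} {t} e =
        -- By computation, the first digit of an index is its quotient by `n`, and the other digits
        -- are those of its remainder.
        let q≡ , r≡ = split (quotient n s) (quotient n t) (remainder {2} n s) (remainder {2} n t) e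
        in remQuot-injective {2} n q≡ r≡

  module _ {r} (g : Fin r → K) where
    bilinear : (Fin r → Fin r → ℕ) → K
    bilinear c = sum (λ i → sum (λ j → c i j ×ℕ (g i * g j)))

    bilinear-cong : ∀ {c d} → (∀ i j → c i j ≡ d i j) → bilinear c ≡ bilinear d
    bilinear-cong e = sum-cong-≗ (λ i → sum-cong-≗ (λ j → cong (_×ℕ (g i * g j)) (e i j)))

    bilinear-+ : ∀ c d → bilinear (λ i j → c i j ℕ.+ d i j) ≡ bilinear c + bilinear d
    bilinear-+ c d = trans
      (sum-cong-≗ (λ i → trans
        (sum-cong-≗ (λ j → ×-homo-+ (g i * g j) (c i j) (d i j)))
        (∑-distrib-+ (λ j → c i j ×ℕ (g i * g j)) (λ j → d i j ×ℕ (g i * g j)))))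
      (∑-distrib-+ (λ i → sum (λ j → c i j ×ℕ (g i * g j))) (λ i → sum (λ j → d i j ×ℕ (g i * g j))))

    bilinear-* : ∀ (a b : Fin r → ℕ) →
      sum (λ i → a i ×ℕ g i) * sum (λ j → b j ×ℕ g j) ≡ bilinear (λ i j → a i ℕ.* b j)
    bilinear-* a b = trans (*-distribʳ-sum _ (λ i → a i ×ℕ g i)) (sum-cong-≗ (λ i → trans (*-distribˡ-sum _ (λ j → b j ×ℕ g j))
      (sum-cong-≗ (λ j → begin
        (a i ×ℕ g i) * (b j ×ℕ g j)    ≡⟨ ×-comm-* (b j) _ _ ⟩
        b j ×ℕ ((a i ×ℕ g i) * g j)    ≡⟨ cong (b j ×ℕ_) (×-assoc-* (a i) _ _) ⟩
        b j ×ℕ (a i ×ℕ (g i * g j))    ≡⟨ ×-assocˡ _ (b j) (a i) ⟩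
        (b j ℕ.* a i) ×ℕ (g i * g j)   ≡⟨ cong (_×ℕ (g i * g j)) (ℕₚ.*-comm (b j) (a i)) ⟩
        (a i ℕ.* b j) ×ℕ (g i * g j)   ∎))))
      where open ≡-Reasoning

    -- The `r * r` digits of `t` in base `suc k` are read as a matrix with entries at most `k`.
    coefficients : ∀ k → Fin (suc k ℕ.^ (r ℕ.* r)) → Fin r → Fin r → ℕ
    coefficients k t i j = toℕ (finToFun t (combine i j))

    coefficients-≤ : ∀ k t i j → coefficients k t i j ℕ.≤ k
    coefficients-≤ k t i j = ℕ.s≤s⁻¹ (Finₚ.toℕ<n (finToFun t (combine i j)))

    coefficients-surjective : ∀ k (c : Fin r → Fin r → ℕ) → (∀ i j → c i j ℕ.≤ k) →
      ∃[ t ] (∀ i j → coefficients k t i j ≡ c i j)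
    coefficients-surjective k c c≤k = funToFin entry , λ i j → begin
      toℕ (finToFun (funToFin entry) (combine i j)) ≡⟨ cong toℕ (Finₚ.finToFun-funToFin entry (combine i j)) ⟩
      toℕ (entry (combine i j))                     ≡⟨ Finₚ.toℕ-fromℕ< _ ⟩
      c (quotient r (combine i j)) (remainder {r} r (combine i j))
                                                    ≡⟨ cong (λ qr → c (proj₁ qr) (proj₂ qr)) (Finₚ.remQuot-combine {r} {r} i j) ⟩
      c i j                                         ∎
      where
      open ≡-Reasoning
      entry : Fin (r ℕ.* r) → Fin (suc k)
      entry s = fromℕ< (s≤s (c≤k (quotient r s) (remainder {r} r s)))

    module Box (k : ℕ) = Deduplication (deduplicate _≟_ (bilinear ∘ coefficients k))
    open Box using () renaming (size to ∣box∣; element to box; within to box-coefficients)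

    ∈box : ∀ k c → (∀ i j → c i j ℕ.≤ k) → ∃[ b ] box k b ≡ bilinear c
    ∈box k c c≤k =
      let t , t≡ = coefficients-surjective k c c≤k
          b , b≡ = Box.covers k t
      in b , trans b≡ (bilinear-cong t≡)

    0<∣box∣ : ∀ k → 0 ℕ.< ∣box∣ k
    0<∣box∣ k with ∣box∣ k | proj₁ (∈box k (λ _ _ → 0) (λ _ _ → z≤n))
    ... | suc n | _ = s≤s z≤n

    digit : Fin (2 ℕ.^ r) → Fin r → ℕ
    digit s i = toℕ (finToFun s i)

    digit≤1 : ∀ s i → digit s i ℕ.≤ 1
    digit≤1 s i = ℕ.s≤s⁻¹ (Finₚ.toℕ<n (finToFun s i))

    -- The product of two subset sums is a bilinear sum with coefficients `0` and `1`, so adding it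
    -- raises the bound on the coefficients by at most one.
    box-step : ∀ k s t b → ∃[ b′ ] box (suc k) b′ ≡ (subset-sum g s * subset-sum g t) + box k b
    box-step k s t b =
      let u  , b≡  = box-coefficients k b
          ε² = λ i j → digit s i ℕ.* digit t j
          b′ , b′≡ = ∈box (suc k) (λ i j → ε² i j ℕ.+ coefficients k u i j)
            (λ i j → ℕₚ.+-mono-≤ {_} {1} (ℕₚ.*-mono-≤ {_} {1} {_} {1} (digit≤1 s i) (digit≤1 t j))
                                   (coefficients-≤ k u i j))
      in b′ , trans b′≡ (trans (bilinear-+ ε² (coefficients k u))
                (cong₂ _+_ (sym (bilinear-* (digit s) (digit t))) (sym b≡)))

  record Configuration (r m : ℕ) : Set where
    field
      ∣B∣ ∣B′∣     : ℕ
      A            : Fin (2 ℕ.^ r) → K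
      B            : Fin ∣B∣ → K
      B′           : Fin ∣B′∣ → K
      A-injective  : Injective _≡_ _≡_ A
      B-injective  : Injective _≡_ _≡_ B
      B′-injective : Injective _≡_ _≡_ B′
      0<∣B∣        : 0 ℕ.< ∣B∣
      ∣B∣≤         : ∣B∣ ℕ.≤ m
      ∣B′∣≤        : ∣B′∣ ℕ.≤ 2 ℕ.* ∣B∣
      AA+B         : ∀ s t b → ∃[ b′ ] B′ b′ ≡ (A s * A t) + B b

  -- The number `K′` bounds both the coefficients and the number of steps. The box for `K′` has
  -- fewer than `2 ^ K′` elements, so `slow-step` finds a bound whose increase by one at most
  -- doubles the box.
  configuration : Infinite K → ∀ r K′ → suc K′ ℕ.^ (r ℕ.* r) ℕ.< 2 ℕ.^ K′ →
                  ¬ ¬ Configuration r (suc K′ ℕ.^ (r ℕ.* r))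
  configuration infinite r K′ few none = distinct-subset-sums infinite r λ { (g , g-inj) → none (build g g-inj) }
    where
    build : (g : Fin r → K) → Injective _≡_ _≡_ (subset-sum g) → Configuration r (suc K′ ℕ.^ (r ℕ.* r))
    build g g-inj with slow-step (Box.size g) K′ (0<∣box∣ g 0) (ℕₚ.≤-<-trans (Box.size≤ g K′) few)
    ... | k , k<K′ , step = record
      { ∣B∣ = Box.size g k ; ∣B′∣ = Box.size g (suc k)
      ; A = subset-sum g ; B = Box.element g k ; B′ = Box.element g (suc k)
      ; A-injective = g-inj ; B-injective = Box.injective g k ; B′-injective = Box.injective g (suc k)
      ; 0<∣B∣ = 0<∣box∣ g k
      ; ∣B∣≤ = ℕₚ.≤-trans (Box.size≤ g k) (ℕₚ.^-monoˡ-≤ (r ℕ.* r) (ℕₚ.m≤n⇒m≤1+n k<K′))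
      ; ∣B′∣≤ = step
      ; AA+B = box-step g k }

-- Quantifier elimination for ordered vector spaces

-- The relation is arbitrary enough to compare pairs by one component, in either direction; the
-- reversed order yields minima.
maximal : ∀ {X : Set} {P : X → Set} {_≺_ : X → X → Set} → (∀ x → Dec (P x)) →
  Decidable _≺_ → Transitive _≺_ → (∀ {x} → ¬ (x ≺ x)) → (xs : List X) →
  (∀ {x} → x ∈ xs → ¬ P x) ⊎ ∃[ m ] (m ∈ xs × P m × (∀ {y} → y ∈ xs → P y → ¬ (m ≺ y)))
maximal P? _≺?_ ≺-trans ≺-irrefl [] = inj₁ λ ()
maximal P? _≺?_ ≺-trans ≺-irrefl (x ∷ xs) with P? x | maximal P? _≺?_ ≺-trans ≺-irrefl xs
... | no ¬p | inj₁ none = inj₁ λ { (here refl) → ¬p ; (there y∈) → none y∈ }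
... | no ¬p | inj₂ (m , m∈ , pm , max) =
  inj₂ (m , there m∈ , pm , λ { (here refl) py → contradiction py ¬p ; (there y∈) → max y∈ })
... | yes p | inj₁ none =
  inj₂ (x , here refl , p , λ { (here refl) _ → ≺-irrefl ; (there y∈) py → contradiction py (none y∈) })
... | yes p | inj₂ (m , m∈ , pm , max) with m ≺? x
...   | yes m≺x = inj₂ (x , here refl , p ,
                    λ { (here refl) _ → ≺-irrefl ; (there y∈) py x≺y → max y∈ py (≺-trans m≺x x≺y) })
...   | no m⊀x  = inj₂ (m , there m∈ , pm , λ { (here refl) _ → m⊀x ; (there y∈) → max y∈ })

-- Back-and-forth in dense linear orders without endpoints

module DenseOrder {A : Set} {_<_ : A → A → Set} (isSTO : IsStrictTotalOrder _≡_ _<_)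
  (point : A) (between : ∀ {x y} → x < y → ∃[ z ] (x < z × z < y))
  (above : ∀ x → ∃[ y ] x < y) (beneath : ∀ x → ∃[ y ] y < x) where

  open Comparison isSTO
  open IsStrictTotalOrder isSTO using (compare; irrefl; _<?_) renaming (trans to <-trans)

  ≮-<-trans : ∀ {x y z} → ¬ (y < x) → y < z → x < z
  ≮-<-trans {x} {y} y≮x y<z with compare x y
  ... | tri< x<y _ _  = <-trans x<y y<z
  ... | tri≈ _ refl _ = y<z
  ... | tri> _ _ y<x  = contradiction y<x y≮x

  <-≮-trans : ∀ {x y z} → x < y → ¬ (z < y) → x < z
  <-≮-trans {z = z} x<y z≮y with compare z _
  ... | tri< z<y _ _  = contradiction z<y z≮y
  ... | tri≈ _ refl _ = x<y
  ... | tri> _ _ y<z  = <-trans x<y y<z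

  PartialIsomorphism : List (A × A) → Set
  PartialIsomorphism ps = ∀ {p q} → p ∈ ps → q ∈ ps →
    cmp (proj₁ p) (proj₁ q) ≡ cmp (proj₂ p) (proj₂ q)

  -- Only the nearest listed values around `a` matter: the greatest one not above it and the least
  -- one above it. An element between their partners, or beyond the only partner that exists, lies
  -- in the corresponding cut.
  back-and-forth : (ps : List (A × A)) → PartialIsomorphism ps →
    ∀ a → ∃[ a′ ] (∀ {p} → p ∈ ps → cmp a (proj₁ p) ≡ cmp a′ (proj₂ p))
  back-and-forth ps iso a = choose lower upper
    where
    lower = maximal {P = λ p → ¬ (a < proj₁ p)} {_≺_ = λ p q → proj₁ p < proj₁ q}
      (λ p → ¬? (a <? proj₁ p)) (λ p q → proj₁ p <? proj₁ q) <-trans (irrefl refl) ps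
    upper = maximal {P = λ p → a < proj₁ p} {_≺_ = λ p q → proj₁ q < proj₁ p}
      (λ p → a <? proj₁ p) (λ p q → proj₁ q <? proj₁ p) (λ r s → <-trans s r) (irrefl refl) ps

    iso-≮ : ∀ {p q} → p ∈ ps → q ∈ ps → ¬ (proj₁ p < proj₁ q) → ¬ (proj₂ p < proj₂ q)
    iso-≮ p∈ q∈ ≮ < = ≮ (cmp-lt⁻ (trans (iso p∈ q∈) (cmp-lt <)))

    place : ∀ a′ → (∀ {q} → q ∈ ps → ¬ (a < proj₁ q) → proj₁ q < a × proj₂ q < a′) →
            (∀ {q} → q ∈ ps → a < proj₁ q → a′ < proj₂ q) →
            ∃[ a′ ] (∀ {p} → p ∈ ps → cmp a (proj₁ p) ≡ cmp a′ (proj₂ p))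
    place a′ lo hi = a′ , λ {q} q∈ → same q q∈ (a <? proj₁ q)
      where
      same : ∀ q → q ∈ ps → Dec (a < proj₁ q) → cmp a (proj₁ q) ≡ cmp a′ (proj₂ q)
      same q q∈ (yes a<q) = trans (cmp-lt a<q) (sym (cmp-lt (hi q∈ a<q)))
      same q q∈ (no a≮q)  = let q<a , q′<a′ = lo q∈ a≮q in
        trans (cmp-gt q<a) (sym (cmp-gt q′<a′))

    choose : _ ⊎ _ → _ ⊎ _ → ∃[ a′ ] (∀ {p} → p ∈ ps → cmp a (proj₁ p) ≡ cmp a′ (proj₂ p))
    choose (inj₁ no-lower) (inj₁ no-upper) = place point
      (λ q∈ a≮q → contradiction a≮q (no-lower q∈)) (λ q∈ a<q → contradiction a<q (no-upper q∈))
    choose (inj₁ no-lower) (inj₂ (h , h∈ , a<h , h-min)) =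
      let a′ , a′<h′ = beneath (proj₂ h) in place a′
      (λ q∈ a≮q → contradiction a≮q (no-lower q∈))
      (λ q∈ a<q → <-≮-trans a′<h′ (iso-≮ q∈ h∈ (h-min q∈ a<q)))
    -- The lower side admits equality, so if `a` is a listed value then it is the maximum there. One
    -- comparison thus decides between copying the partner of `m` and choosing a point in a gap.
    choose (inj₂ (m , m∈ , a≮m , m-max)) up with compare (proj₁ m) a
    ... | tri> _ _ a<m  = contradiction a<m a≮m
    ... | tri≈ _ refl _ = proj₂ m , λ p∈ → iso m∈ p∈
    choose (inj₂ (m , m∈ , a≮m , m-max)) (inj₁ no-upper) | tri< m<a _ _ =
      let a′ , m′<a′ = above (proj₂ m) in place a′
      (λ q∈ a≮q → ≮-<-trans (m-max q∈ a≮q) m<a , ≮-<-trans (iso-≮ m∈ q∈ (m-max q∈ a≮q)) m′<a′)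
      (λ q∈ a<q → contradiction a<q (no-upper q∈))
    choose (inj₂ (m , m∈ , a≮m , m-max)) (inj₂ (h , h∈ , a<h , h-min)) | tri< m<a _ _ =
      let a′ , m′<a′ , a′<h′ = between (cmp-lt⁻ (trans (sym (iso m∈ h∈)) (cmp-lt (<-trans m<a a<h)))) in place a′
      (λ q∈ a≮q → ≮-<-trans (m-max q∈ a≮q) m<a , ≮-<-trans (iso-≮ m∈ q∈ (m-max q∈ a≮q)) m′<a′)
      (λ q∈ a<q → <-≮-trans a′<h′ (iso-≮ q∈ h∈ (h-min q∈ a<q)))

-- Ordered division rings and their ordered vector spaces

module OrderedDivisionRingProperties (D : OrderedDivisionRing) where
  open OrderedDivisionRing D
  open IsStrictTotalOrder isStrictTotalOrder public using (compare; irrefl; asym) renaming (trans to <-trans; _≟_ to _≟ᴰ_)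

  private
    R : Ring 0ℓ 0ℓ
    R = record { isRing = isRing }
  open Ring R public using (+-identityˡ; -‿inverseʳ; -‿inverseˡ; *-identityʳ; distribˡ)
  open Algebra.Properties.Ring R public using (-1*x≈-x; -‿distribʳ-*; -‿involutive; -‿+-comm)

  x<0⇒0<-x : ∀ {x} → x < 0# → 0# < (- x)
  x<0⇒0<-x {x} x<0 = subst₂ _<_ (-‿inverseʳ x) (+-identityˡ (- x)) (+-mono-< (- x) x<0)

  0<1 : 0# < 1#
  0<1 with compare 0# 1#
  ... | tri< 0<1 _ _ = 0<1
  ... | tri≈ _ 0≡1 _ = contradiction 0≡1 0≢1
  ... | tri> _ _ 1<0 = subst (0# <_) (trans (-1*x≈-x (- 1#)) (-‿involutive 1#))
                         (*-pos (x<0⇒0<-x 1<0) (x<0⇒0<-x 1<0))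

  +-pos : ∀ {x y} → 0# < x → 0# < y → 0# < (x + y)
  +-pos {x} {y} 0<x 0<y = <-trans 0<y (subst (_< (x + y)) (+-identityˡ y) (+-mono-< y 0<x))

  half : ∃[ h ] (0# < h × h + h ≡ 1#)
  half with inverse (1# + 1#) (λ 2≡0 → irrefl (sym 2≡0) (+-pos 0<1 0<1))
  ... | h , _ , h*2≡1 = h , 0<h (compare 0# h) , h+h≡1
    where
    h+h≡1 : h + h ≡ 1#
    h+h≡1 = trans (sym (trans (distribˡ h 1# 1#) (cong₂ _+_ (*-identityʳ h) (*-identityʳ h)))) h*2≡1
    0<h : _ → 0# < h
    0<h (tri< p _ _) = p
    0<h (tri≈ _ refl _) = contradiction (trans (sym (+-identityˡ 0#)) h+h≡1) 0≢1
    0<h (tri> _ _ h<0) = contradiction 0<1 (asym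
      (subst₂ _<_ (+-identityˡ 1#) (trans (cong (_+ 1#) (trans (-‿+-comm h h) (cong -_ h+h≡1))) (-‿inverseˡ 1#))
        (+-mono-< 1# (+-pos (x<0⇒0<-x h<0) (x<0⇒0<-x h<0)))))

module OrderedVectorSpaceProperties {D : OrderedDivisionRing} (V : OrderedVectorSpace D) where
  open OrderedVectorSpace V
  module Dₚ = OrderedDivisionRingProperties D
  open IsStrictTotalOrder isStrictTotalOrder public using (compare) renaming (_≟_ to _≟ⱽ_)
  open Comparison isStrictTotalOrder public

  private
    G : AbelianGroup 0ℓ 0ℓ
    G = record { isAbelianGroup = isAbelianGroup }
  open AbelianGroup G public using (assoc; comm; identityˡ; identityʳ; inverseˡ; inverseʳ; commutativeSemigroup)
  open Algebra.Properties.AbelianGroup G public using (inverseˡ-unique; ∙-cancelˡ; x∙y⁻¹≈ε⇒x≈y; ⁻¹-involutive)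
  open Algebra.Properties.CommutativeSemigroup commutativeSemigroup public using (interchange)

  U : Set
  U = OrderedVectorSpace.Carrier V

  0·u≡0 : ∀ u → D.0# · u ≡ 0#
  0·u≡0 u = ∙-cancelˡ (D.0# · u) _ _ (begin
    (D.0# · u) + (D.0# · u) ≡⟨ ·-distribʳ D.0# D.0# u ⟨
    (D.0# D.+ D.0#) · u     ≡⟨ cong (_· u) (Dₚ.+-identityˡ D.0#) ⟩
    D.0# · u                ≡⟨ identityʳ _ ⟨
    (D.0# · u) + 0#         ∎)
    where open ≡-Reasoning

  c·0≡0 : ∀ c → c · 0# ≡ 0#
  c·0≡0 c = ∙-cancelˡ (c · 0#) _ _
    (trans (sym (·-distribˡ c 0# 0#)) (trans (cong (c ·_) (identityˡ 0#)) (sym (identityʳ _))))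

  -c·u : ∀ c u → (D.- c) · u ≡ - (c · u)
  -c·u c u = inverseˡ-unique _ _
    (trans (sym (·-distribʳ (D.- c) c u)) (trans (cong (_· u) (Dₚ.-‿inverseˡ c)) (0·u≡0 u)))

  -1·u : ∀ u → (D.- D.1#) · u ≡ - u
  -1·u u = trans (-c·u D.1# u) (cong -_ (·-identity u))

  +-mono-<ˡ : ∀ {u v} w → u < v → (w + u) < (w + v)
  +-mono-<ˡ w u<v = subst₂ _<_ (comm _ w) (comm _ w) (+-mono-< w u<v)

  neg-anti : ∀ {u v} → (- u) < (- v) → v < u
  neg-anti {u} {v} p = subst₂ _<_ (cancel u v) (trans (cong ((- v) +_) (comm u v)) (cancel v u)) (+-mono-< (u + v) p)
    where
    cancel : ∀ u v → (- u) + (u + v) ≡ v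
    cancel u v = trans (sym (assoc (- u) u v)) (trans (cong (_+ v) (inverseˡ u)) (identityˡ v))

  ·-anti-< : ∀ {c u v} → c D.< D.0# → u < v → (c · v) < (c · u)
  ·-anti-< {c} {u} {v} c<0 u<v = neg-anti
    (subst₂ _<_ (-c·u c u) (-c·u c v) (·-mono-< (Dₚ.x<0⇒0<-x c<0) u<v))

  -- Density comes from the scalar one half: `u = h · u + h · u < h · u + h · v < h · v + h · v =
  -- v`.
  midpoint : ∀ {u v} → u < v → ∃[ w ] (u < w × w < v)
  midpoint {u} {v} u<v with Dₚ.half
  ... | h , 0<h , h+h≡1 =
    (h · u) + (h · v) ,
    subst (_< ((h · u) + (h · v))) (halves u) (+-mono-<ˡ (h · u) hu<hv) ,
    subst (((h · u) + (h · v)) <_) (halves v) (+-mono-< (h · v) hu<hv)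
    where
    hu<hv : (h · u) < (h · v)
    hu<hv = ·-mono-< 0<h u<v
    halves : ∀ w → (h · w) + (h · w) ≡ w
    halves w = trans (sym (·-distribʳ h h w)) (trans (cong (_· w) h+h≡1) (·-identity w))

  <+pos : ∀ {p} u → 0# < p → u < (u + p)
  <+pos {p} u 0<p = subst (_< (u + p)) (identityʳ u) (+-mono-<ˡ u 0<p)

  -pos< : ∀ {p} u → 0# < p → (u + (- p)) < u
  -pos< {p} u 0<p = subst₂ _<_ refl
    (trans (assoc u (- p) p) (trans (cong (u +_) (inverseˡ p)) (identityʳ u)))
    (<+pos (u + (- p)) 0<p)

  positive : ∀ {u v} → ¬ (u ≡ v) → ∃[ p ] 0# < p
  positive {u} {v} u≢v with compare 0# (u + (- v))
  ... | tri< p _ _ = _ , p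
  ... | tri≈ _ 0≡ _ = contradiction (x∙y⁻¹≈ε⇒x≈y u v (sym 0≡)) u≢v
  ... | tri> _ _ p = (- (u + (- v))) , subst₂ _<_ (inverseʳ _) (identityˡ _) (+-mono-< (- (u + (- v))) p)

  sgn : U → Cmp
  sgn u = cmp u 0#

  cmp-+ʳ : ∀ u v w → cmp (u + w) (v + w) ≡ cmp u v
  cmp-+ʳ u v w with compare u v
  ... | tri< p _ _ = cmp-lt (+-mono-< w p)
  ... | tri≈ _ p _ = cmp-eq (cong (_+ w) p)
  ... | tri> _ _ p = cmp-gt (+-mono-< w p)

  sgn-+ : ∀ u v → sgn (u + v) ≡ cmp u (- v)
  sgn-+ u v = trans (cong (cmp (u + v)) (sym (inverseˡ v))) (cmp-+ʳ u (- v) v)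

  sgn-- : ∀ u v → sgn (u + (- v)) ≡ cmp u v
  sgn-- u v = trans (sgn-+ u (- v)) (cong (cmp u) (⁻¹-involutive v))

  cmp-·-pos : ∀ {c} u v → D.0# D.< c → cmp (c · u) (c · v) ≡ cmp u v
  cmp-·-pos {c} u v 0<c with compare u v
  ... | tri< p _ _ = cmp-lt (·-mono-< 0<c p)
  ... | tri≈ _ p _ = cmp-eq (cong (c ·_) p)
  ... | tri> _ _ p = cmp-gt (·-mono-< 0<c p)

  cmp-·-neg : ∀ {c} u v → c D.< D.0# → cmp (c · u) (c · v) ≡ flip (cmp u v)
  cmp-·-neg {c} u v c<0 with compare u v
  ... | tri< p _ _ = cmp-gt (·-anti-< c<0 p)
  ... | tri≈ _ p _ = cmp-eq (cong (c ·_) p)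
  ... | tri> _ _ p = cmp-lt (·-anti-< c<0 p)

  cmp-·-cong : ∀ {c} u v u′ v′ → ¬ (c ≡ D.0#) → cmp u v ≡ cmp u′ v′ →
               cmp (c · u) (c · v) ≡ cmp (c · u′) (c · v′)
  cmp-·-cong {c} u v u′ v′ c≢0 e with Dₚ.compare c D.0#
  ... | tri< c<0 _ _ = trans (cmp-·-neg u v c<0) (trans (cong flip e) (sym (cmp-·-neg u′ v′ c<0)))
  ... | tri≈ _ c≡0 _ = contradiction c≡0 c≢0
  ... | tri> _ _ 0<c = trans (cmp-·-pos u v 0<c) (trans e (sym (cmp-·-pos u′ v′ 0<c)))

  -- Linear forms as coefficient vectors. They have no constant term, as the parameters of a formula
  -- enter as further variables.
  Form : ℕ → Set
  Form = Vec D.Carrier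

  ⟦_⟧ : ∀ {n} → Form n → Vec U n → U
  ⟦ [] ⟧     []      = 0#
  ⟦ c ∷ cs ⟧ (v ∷ ρ) = (c · v) + ⟦ cs ⟧ ρ

  infixl 6 _⊕_ _⊖_
  infixr 7 _⊛_

  _⊕_ _⊖_ : ∀ {n} → Form n → Form n → Form n
  _⊛_ : ∀ {n} → D.Carrier → Form n → Form n
  c ⊕ d = zipWith D._+_ c d
  k ⊛ c = Vec.map (k D.*_) c
  c ⊖ d = c ⊕ (D.- D.1#) ⊛ d

  ⟦⊕⟧ : ∀ {n} (c d : Form n) ρ → ⟦ c ⊕ d ⟧ ρ ≡ ⟦ c ⟧ ρ + ⟦ d ⟧ ρ
  ⟦⊕⟧ []      []      []      = sym (identityˡ 0#)
  ⟦⊕⟧ (c ∷ cs) (d ∷ ds) (v ∷ ρ) =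
    trans (cong₂ _+_ (·-distribʳ c d v) (⟦⊕⟧ cs ds ρ)) (interchange _ _ _ _)

  ⟦⊛⟧ : ∀ {n} k (c : Form n) ρ → ⟦ k ⊛ c ⟧ ρ ≡ k · ⟦ c ⟧ ρ
  ⟦⊛⟧ k []       []      = sym (c·0≡0 k)
  ⟦⊛⟧ k (c ∷ cs) (v ∷ ρ) =
    trans (cong₂ _+_ (·-assoc k c v) (⟦⊛⟧ k cs ρ)) (sym (·-distribˡ k _ _))

  ⟦⊖⟧ : ∀ {n} (c d : Form n) ρ → ⟦ c ⊖ d ⟧ ρ ≡ ⟦ c ⟧ ρ + (- ⟦ d ⟧ ρ)
  ⟦⊖⟧ c d ρ = trans (⟦⊕⟧ c _ ρ) (cong (⟦ c ⟧ ρ +_) (trans (⟦⊛⟧ _ d ρ) (-1·u _)))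

  sgn-⊖ : ∀ {n} (c d : Form n) ρ → sgn (⟦ c ⊖ d ⟧ ρ) ≡ cmp (⟦ c ⟧ ρ) (⟦ d ⟧ ρ)
  sgn-⊖ c d ρ = trans (cong sgn (⟦⊖⟧ c d ρ)) (sgn-- _ _)

  zeroForm : ∀ {n} → Form n
  zeroForm = Vec.replicate _ D.0#

  ⟦zeroForm⟧ : ∀ {n} (ρ : Vec U n) → ⟦ zeroForm ⟧ ρ ≡ 0#
  ⟦zeroForm⟧ []      = refl
  ⟦zeroForm⟧ (v ∷ ρ) = trans (cong₂ _+_ (0·u≡0 v) (⟦zeroForm⟧ ρ)) (identityˡ 0#)

  coordinate : ∀ {n} → Fin n → Form n
  coordinate zero    = D.1# ∷ zeroForm
  coordinate (suc i) = D.0# ∷ coordinate i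

  ⟦coordinate⟧ : ∀ {n} i (ρ : Vec U n) → ⟦ coordinate i ⟧ ρ ≡ lookup ρ i
  ⟦coordinate⟧ zero    (v ∷ ρ) = trans (cong₂ _+_ (·-identity v) (⟦zeroForm⟧ ρ)) (identityʳ v)
  ⟦coordinate⟧ (suc i) (v ∷ ρ) = trans (cong₂ _+_ (0·u≡0 v) (⟦coordinate⟧ i ρ)) (identityˡ _)

  -- Separates the variables of a form, so that its sign can later be read as a comparison of a
  -- function of the point with a function of the line.
  ⟦⟧-++ : ∀ m {n} (c : Form (m ℕ.+ n)) → ∃[ c₁ ] ∃[ c₂ ]
    (∀ (ρ : Vec U m) (σ : Vec U n) → ⟦ c ⟧ (ρ Vec.++ σ) ≡ ⟦ c₁ ⟧ ρ + ⟦ c₂ ⟧ σ)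
  ⟦⟧-++ zero    c       = [] , c , λ { [] σ → sym (identityˡ _) }
  ⟦⟧-++ (suc m) (k ∷ c) with ⟦⟧-++ m c
  ... | c₁ , c₂ , e = k ∷ c₁ , c₂ , λ { (v ∷ ρ) σ →
        trans (cong ((k · v) +_) (e ρ σ)) (sym (assoc _ _ _)) }

  M : Structure (OVSLanguage D.Carrier)
  M = ovsStructure V

  form : ∀ {n} → Term (OVSLanguage D.Carrier) n → Form n
  form (var i)                  = coordinate i
  form (app plus (s ∷ t ∷ []))  = form s ⊕ form t
  form (app (scal k) (t ∷ []))  = k ⊛ form t

  eval-form : ∀ {n} (t : Term (OVSLanguage D.Carrier) n) ρ → eval M t ρ ≡ ⟦ form t ⟧ ρ
  eval-form (var i)                 ρ = sym (⟦coordinate⟧ i ρ)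
  eval-form (app plus (s ∷ t ∷ [])) ρ =
    trans (cong₂ _+_ (eval-form s ρ) (eval-form t ρ)) (sym (⟦⊕⟧ (form s) (form t) ρ))
  eval-form (app (scal k) (t ∷ [])) ρ =
    trans (cong (k ·_) (eval-form t ρ)) (sym (⟦⊛⟧ k (form t) ρ))

  SameSigns : ∀ {n} → List (Form n) → Vec U n → Vec U n → Set
  SameSigns Λ ρ ρ′ = All (λ c → sgn (⟦ c ⟧ ρ) ≡ sgn (⟦ c ⟧ ρ′)) Λ

  SameSigns-sym : ∀ {n} {Λ : List (Form n)} {ρ ρ′} → SameSigns Λ ρ ρ′ → SameSigns Λ ρ′ ρ
  SameSigns-sym = All.map sym

  cmp-eval : ∀ {n} (s t : Term (OVSLanguage D.Carrier) n) {ρ ρ′} →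
    SameSigns ((form s ⊖ form t) ∷ []) ρ ρ′ →
    cmp (eval M s ρ) (eval M t ρ) ≡ cmp (eval M s ρ′) (eval M t ρ′)
  cmp-eval s t {ρ} {ρ′} (e ∷ []) = trans (sym (at ρ)) (trans e (at ρ′))
    where
    at : ∀ ρ → sgn (⟦ form s ⊖ form t ⟧ ρ) ≡ cmp (eval M s ρ) (eval M t ρ)
    at ρ = trans (sgn-⊖ (form s) (form t) ρ) (sym (cong₂ cmp (eval-form s ρ) (eval-form t ρ)))

  -- Solving c·a + λ(ρ) = 0 for a: the forms with c = 0, and the solutions for c ≠ 0.
  parameters thresholds : ∀ {n} → List (Form (suc n)) → List (Form n)
  parameters [] = []
  parameters ((c ∷ λ′) ∷ Λ) with c Dₚ.≟ᴰ D.0#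
  ... | yes _ = λ′ ∷ parameters Λ
  ... | no  _ = parameters Λ
  thresholds [] = []
  thresholds ((c ∷ λ′) ∷ Λ) with c Dₚ.≟ᴰ D.0#
  ... | yes _   = thresholds Λ
  ... | no  c≢0 = (D.- proj₁ (D.inverse c c≢0)) ⊛ λ′ ∷ thresholds Λ

  -- The signs of the differences record the order of the thresholds, which is what back-and-forth
  -- requires.
  project : ∀ {n} → List (Form (suc n)) → List (Form n)
  project Λ = parameters Λ List.++ cartesianProductWith _⊖_ (thresholds Λ) (thresholds Λ)

  threshold-root : ∀ c (c≢0 : ¬ (c ≡ D.0#)) {n} (λ′ : Form n) ρ →
    (c · ⟦ (D.- proj₁ (D.inverse c c≢0)) ⊛ λ′ ⟧ ρ) ≡ - ⟦ λ′ ⟧ ρ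
  threshold-root c c≢0 λ′ ρ with D.inverse c c≢0
  ... | c⁻¹ , cc⁻¹≡1 , _ = begin
    c · ⟦ (D.- c⁻¹) ⊛ λ′ ⟧ ρ    ≡⟨ cong (c ·_) (⟦⊛⟧ (D.- c⁻¹) λ′ ρ) ⟩
    c · ((D.- c⁻¹) · ⟦ λ′ ⟧ ρ)  ≡⟨ ·-assoc c (D.- c⁻¹) _ ⟨
    (c D.* (D.- c⁻¹)) · ⟦ λ′ ⟧ ρ ≡⟨ cong (_· ⟦ λ′ ⟧ ρ) (trans (sym (Dₚ.-‿distribʳ-* c c⁻¹)) (cong D.-_ cc⁻¹≡1)) ⟩
    (D.- D.1#) · ⟦ λ′ ⟧ ρ        ≡⟨ -1·u _ ⟩
    - ⟦ λ′ ⟧ ρ                   ∎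
    where open ≡-Reasoning

  -- For `c ≠ 0` the sign of the form is the comparison of `c · a` with `c · t`, where `t` is its
  -- threshold. Scaling by `c` preserves both comparisons or reverses both, so it suffices that `a`
  -- and `a′` lie in the same cut.
  SameSigns-∷ : ∀ {n} (Λ : List (Form (suc n))) {ρ ρ′ a a′} → SameSigns (parameters Λ) ρ ρ′ →
    (∀ {t} → t ∈ thresholds Λ → cmp a (⟦ t ⟧ ρ) ≡ cmp a′ (⟦ t ⟧ ρ′)) → SameSigns Λ (a ∷ ρ) (a′ ∷ ρ′)
  SameSigns-∷ []              _ _ = []
  SameSigns-∷ ((c ∷ λ′) ∷ Λ) {ρ} {ρ′} {a} {a′} same cut with c Dₚ.≟ᴰ D.0#
  SameSigns-∷ ((c ∷ λ′) ∷ Λ) {ρ} {ρ′} {a} {a′} (e ∷ same) cut | yes refl =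
    trans (drop a ρ) (trans e (sym (drop a′ ρ′))) ∷ SameSigns-∷ Λ same cut
    where
    drop : ∀ a ρ → sgn ((D.0# · a) + ⟦ λ′ ⟧ ρ) ≡ sgn (⟦ λ′ ⟧ ρ)
    drop a ρ = cong sgn (trans (cong (_+ ⟦ λ′ ⟧ ρ) (0·u≡0 a)) (identityˡ _))
  ... | no c≢0 =
    trans (at a ρ) (trans (cmp-·-cong a _ a′ _ c≢0 (cut (here refl))) (sym (at a′ ρ′)))
      ∷ SameSigns-∷ Λ same (cut ∘ there)
    where
    at : ∀ a ρ → sgn ((c · a) + ⟦ λ′ ⟧ ρ) ≡
                 cmp (c · a) (c · ⟦ (D.- proj₁ (D.inverse c c≢0)) ⊛ λ′ ⟧ ρ)
    at a ρ = trans (sgn-+ _ _) (cong (cmp (c · a)) (sym (threshold-root c c≢0 λ′ ρ)))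

  -- Adding or subtracting a positive vector shows that the order has no endpoints; with midpoints
  -- this makes back-and-forth available.
  module Nontrivial {p : U} (0<p : 0# < p) where
    open DenseOrder isStrictTotalOrder 0# midpoint
      (λ u → u + p , <+pos u 0<p) (λ u → u + (- p) , -pos< u 0<p) using (back-and-forth)

    -- The thresholds evaluated at `ρ` and at `ρ′` form a partial isomorphism, and back-and-forth
    -- transfers the cut of `a`.
    extend : ∀ {n} (Λ : List (Form (suc n))) {ρ ρ′} → SameSigns (project Λ) ρ ρ′ →
             ∀ a → ∃[ a′ ] SameSigns Λ (a ∷ ρ) (a′ ∷ ρ′)
    extend Λ {ρ} {ρ′} same a =
      let a′ , cut = back-and-forth (List.map values T) iso a
      in a′ , SameSigns-∷ Λ (Allₚ.++⁻ˡ (parameters Λ) same) (λ t∈ → cut (∈-map⁺ values t∈))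
      where
      T = thresholds Λ
      values : Form _ → U × U
      values t = ⟦ t ⟧ ρ , ⟦ t ⟧ ρ′
      iso : ∀ {x y} → x ∈ List.map values T → y ∈ List.map values T →
            cmp (proj₁ x) (proj₁ y) ≡ cmp (proj₂ x) (proj₂ y)
      iso x∈ y∈ with ∈-map⁻ values x∈ | ∈-map⁻ values y∈
      ... | s , s∈ , refl | t , t∈ , refl =
        trans (sym (sgn-⊖ s t ρ))
          (trans (All.lookup (Allₚ.++⁻ʳ (parameters Λ) same) (∈-cartesianProductWith⁺ _⊖_ s∈ t∈))
            (sgn-⊖ s t ρ′))

    -- Quantifier elimination in semantic form: instead of a quantifier-free formula, it yields
    -- finitely many forms whose signs fix the truth value. Invariance passes through every
    -- connective without deciding whether a formula holds.
    signs-decide : ∀ {n} (φ : Formula (OVSLanguage D.Carrier) n) →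
      ∃[ Λ ] (∀ {ρ ρ′} → SameSigns Λ ρ ρ′ → Sat M φ ρ → Sat M φ ρ′)
    signs-decide (rel less (s ∷ t ∷ [])) =
      (form s ⊖ form t) ∷ [] , λ same s<t → cmp-lt⁻ (trans (sym (cmp-eval s t same)) (cmp-lt s<t))
    signs-decide (equ s t) =
      (form s ⊖ form t) ∷ [] , λ same s≡t → cmp-eq⁻ (trans (sym (cmp-eval s t same)) (cmp-eq s≡t))
    signs-decide fls = [] , λ _ ()
    signs-decide (neg φ) with signs-decide φ
    ... | Λ , inv = Λ , λ same ¬φ φ′ → ¬φ (inv (SameSigns-sym same) φ′)
    signs-decide (conj φ ψ) with signs-decide φ | signs-decide ψ
    ... | Λ , inv | Λ′ , inv′ = Λ List.++ Λ′ , λ same →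
          Product.map (inv (Allₚ.++⁻ˡ Λ same)) (inv′ (Allₚ.++⁻ʳ Λ same))
    signs-decide (disj φ ψ) with signs-decide φ | signs-decide ψ
    ... | Λ , inv | Λ′ , inv′ = Λ List.++ Λ′ , λ same →
          Sum.map (inv (Allₚ.++⁻ˡ Λ same)) (inv′ (Allₚ.++⁻ʳ Λ same))
    signs-decide (impl φ ψ) with signs-decide φ | signs-decide ψ
    ... | Λ , inv | Λ′ , inv′ = Λ List.++ Λ′ , λ same f φ′ →
          inv′ (Allₚ.++⁻ʳ Λ same) (f (inv (SameSigns-sym (Allₚ.++⁻ˡ Λ same)) φ′))
    -- An instance `a′` over `ρ′` is pulled back to one over `ρ`, hence the use of symmetry.
    signs-decide (all φ) with signs-decide φ
    ... | Λ , inv = project Λ , λ same f a′ →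
          let a , same′ = extend Λ (SameSigns-sym same) a′ in inv (SameSigns-sym same′) (f a)
    signs-decide (ex φ) with signs-decide φ
    ... | Λ , inv = project Λ , λ { same (a , φa) →
          let a′ , same′ = extend Λ same a in a′ , inv same′ φa }

-- Point-line incidence in a trace of an ordered vector space

module _ (F : Field) where
  open Field F using (_+_; _*_)

  Incident : Field.Carrier F × Field.Carrier F → Field.Carrier F × Field.Carrier F → Set
  Incident (x , y) (a , b) = y ≡ (a * x) + b

  incidence : Formula RingLanguage 4
  incidence = equ y (app add (app mul (a ∷ x ∷ []) ∷ b ∷ []))
    where
    x y a b : Term RingLanguage 4
    x = var zero
    y = var (suc zero)
    a = var (suc (suc zero))
    b = var (suc (suc (suc zero)))

module _ (F : Field) (_≟_ : DecidableEquality (Field.Carrier F)) (infinite : Infinite (Field.Carrier F))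
  {A : Set} {_<_ : A → A → Set} (isSTO : IsStrictTotalOrder _≡_ _<_) where

  open FieldConfigurations F _≟_

  -- A combinatorial statement about linear orders: the vector space has done its work once
  -- incidence is reduced to comparisons. The two counts of incidences contradict `gain`.
  incidence-not-decided-by-comparisons : (Q : List ((K × K → A) × (K × K → A))) →
    ¬ (∀ {p l p′ l′} → AllSameCmp isSTO Q p l p′ l′ → Incident F p l → Incident F p′ l′)
  incidence-not-decided-by-comparisons Q decides =
    configuration infinite r (2 ℕ.^ r) few λ C → ℕₚ.<⇒≱ gain (2^r≤3q C)
    where
    open Sizes (sizes (List.length Q))
    open Field F using (_+_; _*_)
    q = codes k ℕ.^ List.length Q
    n = 2 ℕ.^ r

    module _ (C : Configuration r (suc n ℕ.^ (r ℕ.* r))) where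
      open Configuration C renaming (A to X)

      point : Fin (n ℕ.* ∣B′∣) → K × K
      point i = X (quotient ∣B′∣ i) , B′ (remainder {n} ∣B′∣ i)

      line : Fin (n ℕ.* ∣B∣) → K × K
      line j = X (quotient ∣B∣ j) , B (remainder {n} ∣B∣ j)

      point-injective : Injective _≡_ _≡_ point
      point-injective e = remQuot-injective {n} ∣B′∣ (A-injective (cong proj₁ e)) (B′-injective (cong proj₂ e))

      line-injective : Injective _≡_ _≡_ line
      line-injective e = remQuot-injective {n} ∣B∣ (A-injective (cong proj₁ e)) (B-injective (cong proj₂ e))

      -- An edge is given by a line and an abscissa in `X`; the ordinate is then forced, and `AA+B`
      -- places it in `B′`.
      edge-line : Fin (n ℕ.* (n ℕ.* ∣B∣)) → Fin (n ℕ.* ∣B∣)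
      edge-line = remainder {n} (n ℕ.* ∣B∣)

      edge-x : Fin (n ℕ.* (n ℕ.* ∣B∣)) → Fin n
      edge-x = quotient (n ℕ.* ∣B∣)

      edge-y : ∀ i → ∃[ b′ ] B′ b′ ≡ (proj₁ (line (edge-line i)) * X (edge-x i)) + proj₂ (line (edge-line i))
      edge-y i = AA+B _ _ _

      edge : Fin (n ℕ.* (n ℕ.* ∣B∣)) → Fin (n ℕ.* ∣B′∣) × Fin (n ℕ.* ∣B∣)
      edge i = combine (edge-x i) (proj₁ (edge-y i)) , edge-line i

      edge-injective : Injective _≡_ _≡_ edge
      edge-injective e = remQuot-injective {n} (n ℕ.* ∣B∣)
        (Finₚ.combine-injectiveˡ {m = n} {n = ∣B′∣} _ _ _ _ (cong proj₁ e)) (cong proj₂ e)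

      edge-incident : ∀ i → Incident F (point (proj₁ (edge i))) (line (proj₂ (edge i)))
      edge-incident i = subst (λ p → Incident F p (line (edge-line i)))
        (cong (Product.map X B′) (sym (Finₚ.remQuot-combine {n} {∣B′∣} (edge-x i) (proj₁ (edge-y i)))))
        (proj₂ (edge-y i))

      -- The factor `3` is two for the points, by `∣B′∣≤`, and one for the lines.
      vertices≤ : n ℕ.* ∣B′∣ ℕ.+ n ℕ.* ∣B∣ ℕ.≤ 3 ℕ.* (n ℕ.* ∣B∣)
      vertices≤ = begin
        n ℕ.* ∣B′∣ ℕ.+ n ℕ.* ∣B∣          ≤⟨ ℕₚ.+-monoˡ-≤ (n ℕ.* ∣B∣) (ℕₚ.*-monoʳ-≤ n ∣B′∣≤) ⟩
        n ℕ.* (2 ℕ.* ∣B∣) ℕ.+ n ℕ.* ∣B∣   ≡⟨ three n ∣B∣ ⟩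
        3 ℕ.* (n ℕ.* ∣B∣)                 ∎
        where
        open ℕₚ.≤-Reasoning
        three : ∀ n b → n ℕ.* (2 ℕ.* b) ℕ.+ n ℕ.* b ≡ 3 ℕ.* (n ℕ.* b)
        three = solve-∀

      colouring : RectangularColouring q
        (λ i j i′ j′ → Incident F (point i) (line j) → Incident F (point i′) (line j′))
      colouring = record
        { colour = colour ; rectangular = rectangular ; refines = decides ∘ refines }
        where
        open RectangularColouring (comparisons-colouring isSTO k Q point line
          (ℕₚ.≤-<-trans vertices≤ (ℕₚ.≤-<-trans (ℕₚ.*-monoʳ-≤ 3 (ℕₚ.*-monoʳ-≤ n ∣B∣≤)) room)))

      edges≤ : n ℕ.* (n ℕ.* ∣B∣) ℕ.≤ q ℕ.* (n ℕ.* ∣B′∣ ℕ.+ n ℕ.* ∣B∣)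
      edges≤ = K₂₂-free-bound (λ i j → Incident F (point i) (line j)) colouring
        (λ e₁ e₂ e₃ e₄ → Sum.map (point-injective ∘ uncurry (cong₂ _,_)) (line-injective ∘ uncurry (cong₂ _,_))
          (two-lines-meet-once e₁ e₂ e₃ e₄))
        edge edge-injective edge-incident

      2^r≤3q : n ℕ.≤ 3 ℕ.* q
      -- The number of lines is cancelled, which uses `0<∣B∣`.
      2^r≤3q = ℕₚ.*-cancelʳ-≤ n (3 ℕ.* q) (n ℕ.* ∣B∣)
        {{ℕₚ.m*n≢0 n ∣B∣ {{ℕₚ.m^n≢0 2 r}} {{ℕ.>-nonZero 0<∣B∣}}}}
        (begin
        n ℕ.* (n ℕ.* ∣B∣)                      ≤⟨ edges≤ ⟩
        q ℕ.* (n ℕ.* ∣B′∣ ℕ.+ n ℕ.* ∣B∣)       ≤⟨ ℕₚ.*-monoʳ-≤ q vertices≤ ⟩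
        q ℕ.* (3 ℕ.* (n ℕ.* ∣B∣))              ≡⟨ regroup q (n ℕ.* ∣B∣) ⟩
        3 ℕ.* q ℕ.* (n ℕ.* ∣B∣)                ∎)
        where
        open ℕₚ.≤-Reasoning
        regroup : ∀ q e → q ℕ.* (3 ℕ.* e) ≡ 3 ℕ.* q ℕ.* e
        regroup = solve-∀

theorem6p6 : (D : OrderedDivisionRing) (V : OrderedVectorSpace D) (F : Field) →
    Infinite (Field.Carrier F) → ¬ TraceDefines (ovsStructure V) (fieldStructure F)
theorem6p6 D V F infinite (m , τ , τ-injective , definable)
  -- Trace definability is applied to incidence, a subset of the fourth power of the field defined
  -- without parameters.
  with definable 4 0 (incidence F) []
... | k′ , ψ , d , represents =
  incidence-not-decided-by-comparisons F _≟_ infinite (OrderedVectorSpace.isStrictTotalOrder V)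
    comparisons decides
  where
  open OrderedVectorSpaceProperties V
  open OrderedVectorSpace V using (_+_; -_; 0#; _<_; isStrictTotalOrder)
  C = Field.Carrier F

  -- The order of `V` is decidable, so equality in the field is decided through the injection `τ`.
  _≟_ : DecidableEquality C
  x ≟ y with Vecₚ.≡-dec _≟ⱽ_ (τ x) (τ y)
  ... | yes e = yes (τ-injective e)
  ... | no ¬e = no (¬e ∘ cong τ)

  distinct-coordinate : ∀ {n} (v w : Vec U n) → ¬ (v ≡ w) → ∃[ p ] 0# < p
  distinct-coordinate []      []      v≢w = contradiction refl v≢w
  distinct-coordinate (u ∷ v) (t ∷ w) v≢w with u ≟ⱽ t
  ... | yes refl = distinct-coordinate v w (v≢w ∘ cong (u ∷_))
  ... | no u≢t   = positive u≢t

  -- The field elements zero and one have distinct images, which differ in some coordinate; that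
  -- difference or its negative is positive.
  open Nontrivial (proj₂ (distinct-coordinate (τ (Field.0# F)) (τ (Field.1# F))
    (Field.0≢1 F ∘ τ-injective)))

  Λ = proj₁ (signs-decide ψ)

  assignment : C × C → C × C → Vec U (4 ℕ.* m ℕ.+ k′)
  assignment (x , y) (a , b) = Vec.concat (Vec.map τ (x ∷ y ∷ a ∷ b ∷ [])) Vec.++ d

  -- A sum of a point part and a line part is compared with zero by comparing the first with the
  -- negative of the second. The contribution of the parameters `d` is put on the side of the line.
  separate : (c : Form (4 ℕ.* m ℕ.+ k′)) → Σ[ uw ∈ (C × C → U) × (C × C → U) ]
    (∀ p l → sgn (⟦ c ⟧ (assignment p l)) ≡ cmp (proj₁ uw p) (proj₂ uw l))
  separate c with ⟦⟧-++ (4 ℕ.* m) c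
  ... | cᶠ , cᵈ , split with ⟦⟧-++ m cᶠ
  ...   | cˣ , cʸˡ , splitˣ with ⟦⟧-++ m cʸˡ
  ...     | cʸ , cˡ , splitʸ =
    ((λ { (x , y) → ⟦ cˣ ⟧ (τ x) + ⟦ cʸ ⟧ (τ y) }) ,
     (λ { (a , b) → - (⟦ cˡ ⟧ (lineᵛ a b) + ⟦ cᵈ ⟧ d) })) ,
    λ { (x , y) (a , b) → trans (cong sgn (begin
      ⟦ c ⟧ (assignment (x , y) (a , b))
        ≡⟨ split _ d ⟩
      ⟦ cᶠ ⟧ (τ x Vec.++ (τ y Vec.++ lineᵛ a b)) + ⟦ cᵈ ⟧ d
        ≡⟨ cong (_+ ⟦ cᵈ ⟧ d) (trans (splitˣ (τ x) _) (cong (⟦ cˣ ⟧ (τ x) +_) (splitʸ (τ y) _))) ⟩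
      (⟦ cˣ ⟧ (τ x) + (⟦ cʸ ⟧ (τ y) + ⟦ cˡ ⟧ (lineᵛ a b))) + ⟦ cᵈ ⟧ d
        ≡⟨ cong (_+ ⟦ cᵈ ⟧ d) (assoc _ _ _) ⟨
      ((⟦ cˣ ⟧ (τ x) + ⟦ cʸ ⟧ (τ y)) + ⟦ cˡ ⟧ (lineᵛ a b)) + ⟦ cᵈ ⟧ d
        ≡⟨ assoc _ _ _ ⟩
      (⟦ cˣ ⟧ (τ x) + ⟦ cʸ ⟧ (τ y)) + (⟦ cˡ ⟧ (lineᵛ a b) + ⟦ cᵈ ⟧ d) ∎)) (sgn-+ _ _) }
    where
    open ≡-Reasoning
    lineᵛ : C → C → Vec U (2 ℕ.* m)
    lineᵛ a b = Vec.concat (Vec.map τ (a ∷ b ∷ []))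

  comparisons : List ((C × C → U) × (C × C → U))
  comparisons = List.map (proj₁ ∘ separate) Λ

  decides : ∀ {p l p′ l′} → AllSameCmp isStrictTotalOrder comparisons p l p′ l′ →
            Incident F p l → Incident F p′ l′
  decides {p} {l} {p′} {l′} same = from p′ l′ ∘ proj₂ (signs-decide ψ) sameSigns ∘ to p l
    where
    to : ∀ p l → Incident F p l → Sat M ψ (assignment p l)
    to (x , y) (a , b) = Equivalence.to (represents (x ∷ y ∷ a ∷ b ∷ []))
    from : ∀ p l → Sat M ψ (assignment p l) → Incident F p l
    from (x , y) (a , b) = Equivalence.from (represents (x ∷ y ∷ a ∷ b ∷ []))
    sameSigns : SameSigns Λ (assignment p l) (assignment p′ l′)
    sameSigns = All.map (λ {c} e → trans (proj₂ (separate c) p l) (trans e (sym (proj₂ (separate c) p′ l′))))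
      (Allₚ.map⁻ same)
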